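{- Let $\alpha,\beta<\gamma$. There exists a graph $G$ (with a root vertex), on $n$ vertices, and an $(\alpha,\beta,\gamma)$-partition hierarchy $\mathcal H$ of $G$ such that any spanning tree $T$ of $G$ that strictly obeys $\mathcal H$ has stretch $\Omega\big((\alpha\beta)^{\frac{\log_\gamma n}{4}}\,\gamma\big)$.
   Context: Graphs $G=(V,E,w)$ are finite, weighted, undirected (and connected), with positive edge lengths $w$; without loss of generality the minimum edge length is $1$; $n=|V|$. $d(u,v)$ is the shortest-path distance in $G$, $B(v,\rho)$ is the set of vertices at distance at most $\rho$ from $v$, and $\mathrm{Diam}(G)$ is the maximum distance between two vertices. Stretch: fix a root $r\in V$. For $X\subseteq V$, $\mathrm{Opt}(X)$ is the minimum cost (sum of edge lengths) of a tree in $G$ connecting $X\cup\{r\}$. For a spanning tree $T$, $T_X$ is the minimal subtree of $T$ rooted at $r$ that contains $X$. The stretch of $T$ is $\max_{X\subseteq V}\mathrm{cost}(T_X)/\mathrm{Opt}(X)$ (trivial $X\subseteq\{r\}$ disregarded). $(\alpha,\beta,\gamma)$-partition: a partition $\mathcal P$ of $V$ into clusters such that (1) for every $C\in\mathcal P$ the induced subgraph $G[C]$ has diameter (strong diameter) at most $\alpha\gamma$; (2) for every $v\in V$, $B(v,\gamma)$ intersects at most $\beta$ clusters of $\mathcal P$. $(\alpha,\beta,\gamma)$-partition hierarchy (for $\gamma>1$): a sequence $\mathcal H=\langle\mathcal P_0,\dots,\mathcal P_d\rangle$ of partitions of $V$, $d=\lceil\log_\gamma(\mathrm{Diam}(G)/\alpha)\rceil$,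 such that (1) each $\mathcal P_i$, $0\le i\le d$, is an $(\alpha,\beta,\gamma^i)$-partition of $G$, and $\mathcal P_d=\{V\}$; (2) for $0\le i<d$ every cluster of $\mathcal P_i$ is contained in a cluster of $\mathcal P_{i+1}$; (3) (root padding) for $0\le i\le d$ the ball $B(r,\gamma^i)$ is contained in some cluster of $\mathcal P_i$. A spanning tree $T$ strictly obeys $\mathcal H$ if for each $\mathcal P_i\in\mathcal H$ and each cluster $C\in\mathcal P_i$, the subgraph of $T$ induced by $C$ is connected. $\Omega(\cdot)$ hides an absolute constant; the statement is asymptotic in $n$, i.e. such graphs exist with $n$ arbitrarily large.
   Formalization: The bound is stated for αβ at least some absolute constant K; with no lower bound on αβ the claim with an absolute constant in Ω fails, for example at α=1, β=1.9, γ=1.99, where some strictly obeying tree has stretch O(n^0.02). -}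

module Defs where

open import Algebra.Bundles using (CommutativeRing; Monoid; Semiring)
open import Data.Bool.Base using (Bool; true; false; T; if_then_else_; _∧_)
open import Data.Fin.Base using (Fin; toℕ; inject₁) renaming (suc to fsuc; fromℕ to lastFin)
open import Data.List.Base using (List; _∷_; _∷ʳ_; length)
open import Data.List.Relation.Unary.Linked using (Linked)
open import Data.List.Relation.Unary.Unique.Propositional using (Unique)
open import Data.Nat.Base as ℕ using (ℕ; suc; NonZero; _<ᵇ_)
open import Data.Product.Base using (Σ; Σ-syntax; ∃-syntax; _×_)
open import Data.Sum.Base using (_⊎_)
open import Data.Unit.Base using (⊤)
open import Function.Bundles using (_↔_; Inverse)
open import Level using (Level; _⊔_) renaming (zero to lzero; suc to lsuc)
open import Relation.Binary.Construct.Closure.ReflexiveTransitive using (Star; ε; _◅_)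
open import Relation.Binary.PropositionalEquality.Core using (_≡_; _≢_)
open import Relation.Binary.Structures using (IsStrictTotalOrder; IsDecEquivalence)
open import Relation.Nullary.Negation.Core using (¬_)
import Algebra.Definitions.RawSemiring as RawSemiringDefs
import Algebra.Definitions.RawMonoid as RawMonoidDefs

-- Stands in for the real numbers, of which it is an abstraction (ℚ is another
-- model).  The order is trichotomous, as it is classically for ℝ.
record ArchimedeanOrderedField (c ℓ₁ ℓ₂ : Level) : Set (lsuc (c ⊔ ℓ₁ ⊔ ℓ₂)) where
  infix 4 _<_ _≤_
  field
    commutativeRing : CommutativeRing c ℓ₁

  open CommutativeRing commutativeRing public
  open RawSemiringDefs (Semiring.rawSemiring semiring) public using (_^_)

  fromℕ : ℕ → Carrier
  fromℕ n = RawMonoidDefs._×_ (Monoid.rawMonoid +-monoid) n 1#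

  field
    _<_                : Carrier → Carrier → Set ℓ₂
    isStrictTotalOrder : IsStrictTotalOrder _≈_ _<_
    0<1                : 0# < 1#
    +-monoˡ-<          : ∀ {x y} z → x < y → x + z < y + z
    *-pos              : ∀ {x y} → 0# < x → 0# < y → 0# < x * y
    inverse            : ∀ x → ¬ (x ≈ 0#) → ∃[ y ] x * y ≈ 1#
    archimedean        : ∀ x → ∃[ n ] x < fromℕ n

  _≤_ : Carrier → Carrier → Set (ℓ₁ ⊔ ℓ₂)
  x ≤ y = x < y ⊎ x ≈ y

module Steiner {c ℓ₁ ℓ₂ : Level} (F : ArchimedeanOrderedField c ℓ₁ ℓ₂) where

  open ArchimedeanOrderedField F
  open RawMonoidDefs (Monoid.rawMonoid +-monoid) using (sum)

  -- a · x^((log_g n)/m) ≤ y, for a, y ≥ 0, x ≥ 1, g > 1 and n, m ≥ 1.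
  -- A rational p/q satisfies p/q ≤ log_g n iff g^p ≤ n^q, and the real power
  -- x^((log_g n)/m) is the supremum of x^(p/(m·q)) over these rationals.
  ScaledPowLog≤ : (a x g : Carrier) (n m : ℕ) (y : Carrier) → Set (ℓ₁ ⊔ ℓ₂)
  ScaledPowLog≤ a x g n m y =
    ∀ (p q : ℕ) → NonZero q → g ^ p ≤ fromℕ n ^ q →
    a ^ (m ℕ.* q) * x ^ p ≤ y ^ (m ℕ.* q)

  record Graph : Set (lsuc lzero ⊔ c ⊔ ℓ₁ ⊔ ℓ₂) where
    field
      V          : Set
      order      : ℕ
      enum       : V ↔ Fin order
      adj        : V → V → Bool
      adj-sym    : ∀ u v → adj u v ≡ adj v u
      adj-irrefl : ∀ v → adj v v ≡ false
      -- relevant on adjacent pairs only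
      len        : V → V → Carrier
      len-sym    : ∀ u v → T (adj u v) → len u v ≈ len v u
      1≤len      : ∀ u v → T (adj u v) → 1# ≤ len u v
      len≈1      : ∃[ u ] ∃[ v ] T (adj u v) × len u v ≈ 1#
      connected  : ∀ u v → Star (λ x y → T (adj x y)) u v

  module _ (G : Graph) where
    open Graph G

    -- adjacency in the subgraph induced by C
    Induced : (V → Set) → V → V → Set
    Induced C u v = T (adj u v) × C u × C v

    Everywhere : V → Set
    Everywhere _ = ⊤

    walkLength : ∀ {R : V → V → Set} {u v} → Star R u v → Carrier
    walkLength ε                      = 0#
    walkLength (_◅_ {i = x} {j = y} _ ws) = len x y + walkLength ws

    -- the distance from u to v in G[C] is at most ρ
    Dist≤ : (C : V → Set) → V → V → Carrier → Set (ℓ₁ ⊔ ℓ₂)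
    Dist≤ C u v ρ = Σ[ w ∈ Star (Induced C) u v ] walkLength w ≤ ρ

    Ball : V → Carrier → V → Set (ℓ₁ ⊔ ℓ₂)
    Ball v ρ u = Dist≤ Everywhere v u ρ

    -- the (strong) diameter of G[C] is at most ρ
    Diam≤ : (C : V → Set) → Carrier → Set (ℓ₁ ⊔ ℓ₂)
    Diam≤ C ρ = ∀ u v → C u → C v → Dist≤ C u v ρ

    -- d = ⌈ log_γ (Diam(G)/α) ⌉, that is, α·γ^(d-1) < Diam(G) ≤ α·γ^d
    IsDepth : (α γ : Carrier) → ℕ → Set (ℓ₁ ⊔ ℓ₂)
    IsDepth α γ d =
      Diam≤ Everywhere (α * γ ^ d) ×
      (∃[ u ] ∃[ v ] ∀ (w : Star (Induced Everywhere) u v) →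
        α * γ ^ d < γ * walkLength w)

    -- The clusters are the equivalence classes.
    record Partition : Set₁ where
      field
        _~_              : V → V → Set
        isDecEquivalence : IsDecEquivalence _~_

    record IsPartition (α β γ : Carrier) (P : Partition) : Set (ℓ₁ ⊔ ℓ₂) where
      open Partition P
      field
        strongDiameter : ∀ v → Diam≤ (v ~_) (α * γ)
        -- β bounds the size of every family of points of the ball lying in
        -- pairwise different clusters
        sparse         : ∀ v (k : ℕ) (x : Fin k → V) →
                         (∀ i → Ball v γ (x i)) →
                         (∀ i j → i ≢ j → ¬ (x i ~ x j)) →
                         fromℕ k ≤ β

    record Hierarchy (α β γ : Carrier) (r : V) : Set (lsuc lzero ⊔ ℓ₁ ⊔ ℓ₂) where
      field
        depth       : ℕ
        isDepth     : IsDepth α γ depth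
        part        : Fin (suc depth) → Partition

      _⊢_~_ : Fin (suc depth) → V → V → Set
      i ⊢ u ~ v = Partition._~_ (part i) u v

      field
        isPartition : ∀ i → IsPartition α β (γ ^ toℕ i) (part i)
        top         : ∀ u v → lastFin depth ⊢ u ~ v
        refines     : ∀ (i : Fin depth) {u v} → inject₁ i ⊢ u ~ v → fsuc i ⊢ u ~ v
        rootPadding : ∀ i → ∃[ v ] ∀ u → Ball r (γ ^ toℕ i) u → i ⊢ v ~ u

    record Subgraph : Set where
      field
        vtx      : V → Bool
        edge     : V → V → Bool
        edge-sym : ∀ u v → edge u v ≡ edge v u
        edge⇒adj : ∀ u v → T (edge u v) → T (adj u v)
        edge⇒vtx : ∀ u v → T (edge u v) → T (vtx u)

    open Subgraph

    record _⊑_ (S S′ : Subgraph) : Set where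
      field
        vtx-⊑  : ∀ v → T (vtx S v) → T (vtx S′ v)
        edge-⊑ : ∀ u v → T (edge S u v) → T (edge S′ u v)

    cost : Subgraph → Carrier
    cost S = sum λ (i : Fin order) → sum λ (j : Fin order) →
      if (toℕ i <ᵇ toℕ j) ∧ edge S (from i) (from j)
      then len (from i) (from j) else 0#
      where open Inverse enum using (from)

    IsCycle : Subgraph → V → List V → Set
    IsCycle S v vs =
      Unique (v ∷ vs) × 2 ℕ.≤ length vs ×
      Linked (λ x y → T (edge S x y)) (v ∷ (vs ∷ʳ v))

    record IsTree (S : Subgraph) : Set where
      field
        nonempty      : ∃[ v ] T (vtx S v)
        treeConnected : ∀ u v → T (vtx S u) → T (vtx S v) →
                        Star (λ x y → T (edge S x y)) u v
        acyclic       : ∀ v vs → ¬ IsCycle S v vs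

    IsSpanningTree : Subgraph → Set
    IsSpanningTree S = IsTree S × (∀ v → T (vtx S v))

    StrictlyObeys : ∀ {α β γ r} → Subgraph → Hierarchy α β γ r → Set
    StrictlyObeys τ H = ∀ i u v → i ⊢ u ~ v →
      Star (λ x y → T (edge τ x y) × (i ⊢ u ~ x) × (i ⊢ u ~ y)) u v
      where open Hierarchy H

    module _ (r : V) where

      record SteinerTree (X : V → Bool) (S : Subgraph) : Set where
        field
          isTree       : IsTree S
          containsRoot : T (vtx S r)
          containsX    : ∀ v → T (X v) → T (vtx S v)

      -- o = Opt(X)
      IsOpt : (V → Bool) → Carrier → Set (ℓ₁ ⊔ ℓ₂)
      IsOpt X o =
        (∃[ S ] SteinerTree X S × cost S ≈ o) ×
        (∀ S → SteinerTree X S → o ≤ cost S)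

      -- S = τ_X
      IsMinimalSubtree : Subgraph → (V → Bool) → Subgraph → Set
      IsMinimalSubtree τ X S =
        S ⊑ τ × SteinerTree X S ×
        (∀ S′ → S′ ⊑ S → SteinerTree X S′ → S ⊑ S′)

      Nontrivial : (V → Bool) → Set
      Nontrivial X = ∃[ v ] T (X v) × v ≢ r

      -- s is the maximum of cost(τ_X)/Opt(X)
      IsStretch : Subgraph → Carrier → Set (c ⊔ ℓ₁ ⊔ ℓ₂)
      IsStretch τ s =
        (∀ X S o → Nontrivial X → IsMinimalSubtree τ X S → IsOpt X o →
          cost S ≤ s * o) ×
        (∃[ X ] ∃[ S ] ∃[ o ] Nontrivial X × IsMinimalSubtree τ X S × IsOpt X o ×
          cost S ≈ s * o)

{-# OPTIONS --safe #-}

-- A block of level j + 1 is a chain of k items, each made of a block of level j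
-- with an entrance inn and an exit out, and of a hub joined to both; consecutive
-- items are linked from exit to entrance.  Crossing an item through its hub is
-- cheap, which keeps the diameters small, but a tree connected inside every
-- block has at most one edge from the hub to the block.  Hence its path from inn
-- to out crosses all the k ^ m base pairs, although the root, which is the hub
-- of the block of level m, is a neighbour of both.  Edge lengths grow
-- like γ ^ j / β, which leaves room for k ≈ α β γ items, so that the path exceeds
-- the diameter by a factor of about α β per level, while the order of the graph
-- is at most γ ^ (3 m + 1).  Since 3 < 4, the constants lost at each level and
-- the factor γ are absorbed for α β and m large.

module Submission where

open import Defs
open import Data.Bool.Base using (Bool; true; false; T; if_then_else_; not; _∧_; _∨_)
open import Data.Bool.Properties using (∨-comm; T-≡; T-∨; T-∧) renaming (_≟_ to _≟ᵇ_)
open import Data.Fin.Base as Fin using (Fin; toℕ; punchIn; punchOut; combine; remQuot)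
  renaming (suc to fsuc; zero to fzero; fromℕ to lastFin)
open import Data.List.Base using (List; []; _∷_; _∷ʳ_)
open import Data.List.Membership.Propositional using (_∈_)
open import Data.List.Relation.Unary.All as All using (All; []; _∷_)
open import Data.List.Relation.Unary.AllPairs using ([]; _∷_)
open import Data.List.Relation.Unary.Any using (here; there; any?)
open import Data.List.Relation.Unary.Linked as Linked using (Linked; [-]; _∷_)
open import Data.List.Relation.Unary.Unique.Propositional using (Unique)
open import Data.Maybe.Base using (Maybe; just; nothing)
open import Data.Maybe.Properties using (just-injective)
open import Data.Nat.Base as ℕ using (ℕ; zero; suc; z≤n; s≤s; _<ᵇ_; _∸_; ∣_-_∣)
open import Data.Product.Base using (Σ-syntax; ∃-syntax; _×_; _,_; proj₁; proj₂)
open import Data.Sum.Base as Sum using (_⊎_; inj₁; inj₂; swap)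
open import Data.Unit.Base using (tt)
open import Function.Base using (_∘_)
open import Function.Bundles using (_↔_; Inverse; Equivalence; mk↔ₛ′)
open import Level using (_⊔_)
open import Relation.Binary.Bundles using (StrictPartialOrder)
open import Relation.Binary.Construct.Closure.ReflexiveTransitive as Star using (Star; ε; _◅_; _◅◅_)
open import Relation.Binary.Definitions using (DecidableEquality; tri<; tri≈; tri>)
open import Relation.Binary.PropositionalEquality as ≡ using (_≡_; _≢_; cong; cong₂; subst; subst₂)
open import Relation.Binary.Structures using (IsStrictTotalOrder; IsTotalOrder)
open import Relation.Nullary using (¬_; Dec; yes; no; does; contradiction)
open import Relation.Nullary.Decidable using (⌊_⌋; map′; toWitness; fromWitness)
import Algebra.Properties.CommutativeMonoid.Sum as Sums
import Algebra.Properties.CommutativeSemiring.Exp as Exp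
import Algebra.Properties.Semiring.Mult as Mult
import Algebra.Solver.Ring.NaturalCoefficients.Default as NaturalSolver
import Data.Fin.Properties as Fin
import Data.List.Relation.Unary.All.Properties as All
import Data.Nat.Properties as ℕ
import Relation.Binary.Construct.StrictToNonStrict as NonStrict
import Relation.Binary.Reasoning.StrictPartialOrder as StrictReasoning

-- That the tree path uses every base pair is proved by cuts, without following the path. For each
-- base pair there is a two-colouring of the vertices whose only bichromatic tree edge is that pair;
-- a hub takes the colour of the end to which the tree joins it, which is consistent because it is
-- joined to at most one. All these colourings give the root the same colour, so one target, the end
-- of the outer block with the opposite colour, serves for all pairs at once. The obstacle to
-- sparsity is that a ball may run through many items. Numbering the clusters along a chain bounds
-- how far a short walk can get, so clusters in a ball are counted by integers in an interval. The
-- root edges have length (1 + α) γ ^ (m + 1): the summand 1 gives root padding, the summand α makes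
-- the depth exactly m + 2. This is also Opt of the target. Its power γ ^ m cancels against that in
-- k ^ m ≈ (α β γ) ^ m, and the remaining (1 + α) γ does not depend on m.

-- Arithmetic of ordered fields: order, powers, floors.

module OrderedFieldProperties {c ℓ₁ ℓ₂} (F : ArchimedeanOrderedField c ℓ₁ ℓ₂) where

  open ArchimedeanOrderedField F
  open IsStrictTotalOrder isStrictTotalOrder public
    using (compare; <-resp-≈; isStrictPartialOrder)
    renaming (trans to <-trans; irrefl to <-irrefl; asym to <-asym)
  open Exp commutativeSemiring public
    using (^-congˡ; ^-assocʳ; ^-distrib-*)
  open Mult semiring using (×1-homo-*)
  open NaturalSolver commutativeSemiring public
    using (Polynomial; solve; _:=_; _:+_; _:*_; con)

  strictPartialOrder : StrictPartialOrder c ℓ₁ ℓ₂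
  strictPartialOrder = record { isStrictPartialOrder = isStrictPartialOrder }

  module ≤-Reasoning = StrictReasoning strictPartialOrder

  open IsTotalOrder (NonStrict.isTotalOrder _≈_ _<_ isStrictTotalOrder) public
    using () renaming
    ( refl to ≤-refl; trans to ≤-trans; antisym to ≤-antisym
    ; reflexive to ≤-reflexive )

  <-≤-trans : ∀ {x y z} → x < y → y ≤ z → x < z
  <-≤-trans = NonStrict.<-≤-trans _≈_ _<_ <-trans (proj₁ <-resp-≈)

  ≤-<-trans : ∀ {x y z} → x ≤ y → y < z → x < z
  ≤-<-trans = NonStrict.≤-<-trans _≈_ _<_ sym <-trans (proj₂ <-resp-≈)

  infix 4 _≤?_
  _≤?_ : ∀ x y → Dec (x ≤ y)
  _≤?_ = NonStrict.decidable′ _≈_ _<_ compare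

  ≮⇒≥ : ∀ {x y} → ¬ (x < y) → y ≤ x
  ≮⇒≥ {x} {y} x≮y with compare x y
  ... | tri< x<y _ _ = contradiction x<y x≮y
  ... | tri≈ _ x≈y _ = inj₂ (sym x≈y)
  ... | tri> _ _ y<x = inj₁ y<x

  ≰⇒> : ∀ {x y} → ¬ (x ≤ y) → y < x
  ≰⇒> {x} {y} x≰y with compare x y
  ... | tri< x<y _ _ = contradiction (inj₁ x<y) x≰y
  ... | tri≈ _ x≈y _ = contradiction (inj₂ x≈y) x≰y
  ... | tri> _ _ y<x = y<x

  <⇒≱ : ∀ {x y} → x < y → ¬ (y ≤ x)
  <⇒≱ x<y y≤x = <-irrefl refl (<-≤-trans x<y y≤x)

  +-monoʳ-< : ∀ z {x y} → x < y → z + x < z + y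
  +-monoʳ-< z {x} {y} x<y = begin-strict
    z + x ≈⟨ +-comm z x ⟩
    x + z <⟨ +-monoˡ-< z x<y ⟩
    y + z ≈⟨ +-comm y z ⟩
    z + y ∎
    where open ≤-Reasoning

  +-monoʳ-≤ : ∀ z {x y} → x ≤ y → z + x ≤ z + y
  +-monoʳ-≤ z (inj₁ x<y) = inj₁ (+-monoʳ-< z x<y)
  +-monoʳ-≤ z (inj₂ x≈y) = inj₂ (+-congˡ x≈y)

  +-monoˡ-≤ : ∀ z {x y} → x ≤ y → x + z ≤ y + z
  +-monoˡ-≤ z (inj₁ x<y) = inj₁ (+-monoˡ-< z x<y)
  +-monoˡ-≤ z (inj₂ x≈y) = inj₂ (+-congʳ x≈y)

  +-mono-≤ : ∀ {x y u v} → x ≤ y → u ≤ v → x + u ≤ y + v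
  +-mono-≤ {y = y} {u} x≤y u≤v = ≤-trans (+-monoˡ-≤ u x≤y) (+-monoʳ-≤ y u≤v)

  x≤x+y : ∀ {x y} → 0# ≤ y → x ≤ x + y
  x≤x+y {x} 0≤y = ≤-trans (≤-reflexive (sym (+-identityʳ x))) (+-monoʳ-≤ x 0≤y)

  x≤y+x : ∀ {x y} → 0# ≤ y → x ≤ y + x
  x≤y+x {x} {y} 0≤y = ≤-trans (x≤x+y 0≤y) (≤-reflexive (+-comm x y))

  0≤+ : ∀ {x y} → 0# ≤ x → 0# ≤ y → 0# ≤ x + y
  0≤+ 0≤x 0≤y = ≤-trans 0≤x (x≤x+y 0≤y)

  *-monoˡ-< : ∀ {z x y} → 0# < z → x < y → x * z < y * z
  *-monoˡ-< {z} {x} {y} 0<z x<y = begin-strict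
    x * z                   ≈⟨ +-identityˡ _ ⟨
    0# + x * z              <⟨ +-monoˡ-< _ (*-pos 0<y-x 0<z) ⟩
    (y - x) * z + x * z     ≈⟨ distribʳ z (y - x) x ⟨
    (y - x + x) * z         ≈⟨ *-congʳ (+-assoc y (- x) x) ⟩
    (y + (- x + x)) * z     ≈⟨ *-congʳ (+-congˡ (-‿inverseˡ x)) ⟩
    (y + 0#) * z            ≈⟨ *-congʳ (+-identityʳ y) ⟩
    y * z                   ∎
    where
    open ≤-Reasoning
    0<y-x : 0# < y - x
    0<y-x = begin-strict
      0#    ≈⟨ -‿inverseʳ x ⟨
      x - x <⟨ +-monoˡ-< (- x) x<y ⟩
      y - x ∎

  *-monoˡ-≤ : ∀ {z x y} → 0# ≤ z → x ≤ y → x * z ≤ y * z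
  *-monoˡ-≤ (inj₁ 0<z) (inj₁ x<y) = inj₁ (*-monoˡ-< 0<z x<y)
  *-monoˡ-≤ (inj₂ 0≈z) (inj₁ x<y) = inj₂
    (trans (trans (*-congˡ (sym 0≈z)) (zeroʳ _)) (trans (sym (zeroʳ _)) (*-congˡ 0≈z)))
  *-monoˡ-≤ 0≤z (inj₂ x≈y) = inj₂ (*-congʳ x≈y)

  *-monoʳ-≤ : ∀ {z x y} → 0# ≤ z → x ≤ y → z * x ≤ z * y
  *-monoʳ-≤ {z} {x} {y} 0≤z x≤y = begin
    z * x ≈⟨ *-comm z x ⟩
    x * z ≤⟨ *-monoˡ-≤ 0≤z x≤y ⟩
    y * z ≈⟨ *-comm y z ⟩
    z * y ∎
    where open ≤-Reasoning

  *-monoʳ-< : ∀ {z x y} → 0# < z → x < y → z * x < z * y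
  *-monoʳ-< {z} {x} {y} 0<z x<y = begin-strict
    z * x ≈⟨ *-comm z x ⟩
    x * z <⟨ *-monoˡ-< 0<z x<y ⟩
    y * z ≈⟨ *-comm y z ⟩
    z * y ∎
    where open ≤-Reasoning

  *-mono-≤ : ∀ {x y u v} → 0# ≤ x → 0# ≤ u → x ≤ y → u ≤ v → x * u ≤ y * v
  *-mono-≤ 0≤x 0≤u x≤y u≤v = ≤-trans (*-monoˡ-≤ 0≤u x≤y) (*-monoʳ-≤ (≤-trans 0≤x x≤y) u≤v)

  0≤* : ∀ {x y} → 0# ≤ x → 0# ≤ y → 0# ≤ x * y
  0≤* {x} 0≤x 0≤y = ≤-trans (≤-reflexive (sym (zeroʳ x))) (*-monoʳ-≤ 0≤x 0≤y)

  *-cancelˡ-≤ : ∀ {z x y} → 0# < z → z * x ≤ z * y → x ≤ y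
  *-cancelˡ-≤ 0<z zx≤zy = ≮⇒≥ λ y<x → <⇒≱ (*-monoʳ-< 0<z y<x) zx≤zy

  x≤x*y : ∀ {x y} → 0# ≤ x → 1# ≤ y → x ≤ x * y
  x≤x*y {x} 0≤x 1≤y = ≤-trans (≤-reflexive (sym (*-identityʳ x))) (*-monoʳ-≤ 0≤x 1≤y)

  x≤y*x : ∀ {x y} → 0# ≤ x → 1# ≤ y → x ≤ y * x
  x≤y*x {x} {y} 0≤x 1≤y = ≤-trans (x≤x*y 0≤x 1≤y) (≤-reflexive (*-comm x y))

  0≤1 : 0# ≤ 1#
  0≤1 = inj₁ 0<1

  ^-pos : ∀ {x} n → 0# < x → 0# < x ^ n
  ^-pos zero    0<x = 0<1
  ^-pos (suc n) 0<x = *-pos 0<x (^-pos n 0<x)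

  0≤^ : ∀ {x} n → 0# ≤ x → 0# ≤ x ^ n
  0≤^ zero    0≤x = 0≤1
  0≤^ (suc n) 0≤x = 0≤* 0≤x (0≤^ n 0≤x)

  ^-monoˡ-≤ : ∀ {x y} n → 0# ≤ x → x ≤ y → x ^ n ≤ y ^ n
  ^-monoˡ-≤ zero    0≤x x≤y = ≤-refl
  ^-monoˡ-≤ (suc n) 0≤x x≤y = *-mono-≤ 0≤x (0≤^ n 0≤x) x≤y (^-monoˡ-≤ n 0≤x x≤y)

  1≤^ : ∀ {x} n → 1# ≤ x → 1# ≤ x ^ n
  1≤^ zero    1≤x = ≤-refl
  1≤^ (suc n) 1≤x = ≤-trans (1≤^ n 1≤x) (x≤y*x (0≤^ n (≤-trans 0≤1 1≤x)) 1≤x)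

  ^-monoʳ-≤ : ∀ {x m n} → 1# ≤ x → m ℕ.≤ n → x ^ m ≤ x ^ n
  ^-monoʳ-≤ 1≤x (z≤n {n}) = 1≤^ n 1≤x
  ^-monoʳ-≤ {m = suc m} 1≤x (s≤s m≤n) =
    *-monoʳ-≤ (≤-trans 0≤1 1≤x) (^-monoʳ-≤ 1≤x m≤n)

  ^-cancel-≤ : ∀ {x m n} → 1# < x → x ^ m ≤ x ^ n → m ℕ.≤ n
  ^-cancel-≤ {x} {m} {n} 1<x xᵐ≤xⁿ with m ℕ.≤? n
  ... | yes m≤n = m≤n
  ... | no m≰n = contradiction xᵐ≤xⁿ (<⇒≱ (begin-strict
    x ^ n       ≈⟨ *-identityˡ _ ⟨
    1# * x ^ n  <⟨ *-monoˡ-< (^-pos n (<-trans 0<1 1<x)) 1<x ⟩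
    x ^ suc n   ≤⟨ ^-monoʳ-≤ {m = suc n} (inj₁ 1<x) (ℕ.≰⇒> m≰n) ⟩
    x ^ m       ∎))
    where open ≤-Reasoning

  fromℕ-* : ∀ m n → fromℕ (m ℕ.* n) ≈ fromℕ m * fromℕ n
  fromℕ-* = ×1-homo-*

  fromℕ-^ : ∀ m n → fromℕ (m ℕ.^ n) ≈ fromℕ m ^ n
  fromℕ-^ m zero    = +-identityʳ 1#
  fromℕ-^ m (suc n) = trans (fromℕ-* m (m ℕ.^ n)) (*-congˡ (fromℕ-^ m n))

  0≤fromℕ : ∀ n → 0# ≤ fromℕ n
  0≤fromℕ zero    = ≤-refl
  0≤fromℕ (suc n) = 0≤+ 0≤1 (0≤fromℕ n)

  fromℕ-mono-≤ : ∀ {m n} → m ℕ.≤ n → fromℕ m ≤ fromℕ n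
  fromℕ-mono-≤ (z≤n {n}) = 0≤fromℕ n
  fromℕ-mono-≤ (s≤s m≤n) = +-monoʳ-≤ 1# (fromℕ-mono-≤ m≤n)

  0<fromℕ-suc : ∀ n → 0# < fromℕ (suc n)
  0<fromℕ-suc n = <-≤-trans 0<1 (x≤x+y (0≤fromℕ n))

  -- The search counts down from an archimedean bound of x, which is also a bound in units of u
  -- because 1 ≤ u.
  floor : ∀ u x → 1# ≤ u → 0# ≤ x → ∃[ n ] fromℕ n * u ≤ x × x < fromℕ (suc n) * u
  floor u x 1≤u 0≤x with archimedean x
  ... | n , x<n = search n (<-≤-trans x<n (x≤x*y (0≤fromℕ n) 1≤u))
    where
    search : ∀ n → x < fromℕ n * u → ∃[ n ] fromℕ n * u ≤ x × x < fromℕ (suc n) * u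
    search zero    x<0 = contradiction 0≤x (<⇒≱ (<-≤-trans x<0 (≤-reflexive (zeroˡ u))))
    search (suc n) x<su with fromℕ n * u ≤? x
    ... | yes nu≤x = n , nu≤x , x<su
    ... | no  nu≰x = search n (≰⇒> nu≰x)


  -- Follows the recursion of `fromℕ`, so that solver numerals match the terms `fromℕ i` of the
  -- goals.
  num : ∀ {n} → ℕ → Polynomial n
  num zero    = con 0
  num (suc i) = con 1 :+ num i

  fromℕ≤2^ : ∀ n → fromℕ n ≤ fromℕ 2 ^ n
  fromℕ≤2^ zero    = 0≤1
  fromℕ≤2^ (suc n) = begin
    1# + fromℕ n                    ≤⟨ +-mono-≤ (1≤^ n 1≤2) (fromℕ≤2^ n) ⟩
    fromℕ 2 ^ n + fromℕ 2 ^ n       ≈⟨ solve 1 (λ x → x :+ x := num 2 :* x) refl (fromℕ 2 ^ n) ⟩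
    fromℕ 2 ^ suc n                 ∎
    where
    open ≤-Reasoning
    1≤2 : 1# ≤ fromℕ 2
    1≤2 = x≤x+y (0≤fromℕ 1)

-- Blocks: their vertices, edges and clusters.

module Blocks (k′ : ℕ) where

  open import Data.Nat.Base using (_+_; _*_; _^_; _≤_; _<_; _≡ᵇ_)
  open import Data.Nat.Properties using (≤-trans; ≤-refl)
  open ≡ using (refl; sym; trans)

  k : ℕ
  k = suc k′

  -- `Maybe` adjoins the hub: `a ▸ nothing` is the hub of item `a`, and `a ▸ just u` a vertex of its
  -- block. A block together with its hub is a `Cell`; the whole graph will be `Cell m`, with the
  -- root as outermost hub.
  data Block : ℕ → Set where
    end : Bool → Block 0
    _▸_ : ∀ {j} → Fin k → Maybe (Block j) → Block (suc j)

  Cell : ℕ → Set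
  Cell j = Maybe (Block j)

  inn out : ∀ j → Block j
  inn zero    = end false
  inn (suc j) = fzero ▸ just (inn j)
  out zero    = end true
  out (suc j) = lastFin k′ ▸ just (out j)

  infix 4 _↝_ _↝ᶜ_
  -- Every edge is listed in one direction only, away from a hub or from the entrance towards the
  -- exit. Adjacency is the symmetric closure, and facts about edges need one case each.
  data _↝_ : ∀ {j} → Block j → Block j → Set
  data _↝ᶜ_ : ∀ {j} → Cell j → Cell j → Set

  data _↝_ where
    pair : end false ↝ end true
    item : ∀ {j a} {x y : Cell j} → x ↝ᶜ y → a ▸ x ↝ a ▸ y
    link : ∀ {j a b} → toℕ b ≡ suc (toℕ a) → a ▸ just (out j) ↝ b ▸ just (inn j)

  data _↝ᶜ_ where
    entry  : ∀ {j} → nothing ↝ᶜ just (inn j)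
    exit   : ∀ {j} → nothing ↝ᶜ just (out j)
    inside : ∀ {j} {u v : Block j} → u ↝ v → just u ↝ᶜ just v

  -- The least level at which the two vertices share a cluster.  It also
  -- determines the length of an edge.
  sep : ∀ {j} → Block j → Block j → ℕ
  sepᶜ : ∀ {j} → Cell j → Cell j → ℕ
  sep (end false) (end false) = 0
  sep (end false) (end true)  = 1
  sep (end true)  (end false) = 1
  sep (end true)  (end true)  = 0
  sep {suc j} (a ▸ x) (b ▸ y) = if does (a Fin.≟ b) then sepᶜ x y else suc (suc j)
  sepᶜ nothing  nothing  = 0
  sepᶜ (just u) (just v) = sep u v
  sepᶜ {j} nothing  (just v) = suc (suc j)
  sepᶜ {j} (just u) nothing  = suc (suc j)

  sep-▸ : ∀ {j} a (x y : Cell j) → sep (a ▸ x) (a ▸ y) ≡ sepᶜ x y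
  sep-▸ a x y with a Fin.≟ a
  ... | yes _   = refl
  ... | no  a≢a = contradiction refl a≢a

  sep-▸-≢ : ∀ {j a b} {x y : Cell j} → a ≢ b → sep (a ▸ x) (b ▸ y) ≡ suc (suc j)
  sep-▸-≢ {a = a} {b} a≢b with a Fin.≟ b
  ... | yes a≡b = contradiction a≡b a≢b
  ... | no  _   = refl

  sep-bound : ∀ {j} (u v : Block j) → sep u v ≤ suc j
  sepᶜ-bound : ∀ {j} (x y : Cell j) → sepᶜ x y ≤ suc (suc j)
  sep-bound (end false) (end false) = z≤n
  sep-bound (end false) (end true)  = ≤-refl
  sep-bound (end true)  (end false) = ≤-refl
  sep-bound (end true)  (end true)  = z≤n
  sep-bound (a ▸ x) (b ▸ y) with a Fin.≟ b
  ... | yes _ = sepᶜ-bound x y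
  ... | no  _ = ≤-refl
  sepᶜ-bound nothing  nothing  = z≤n
  sepᶜ-bound nothing  (just v) = ≤-refl
  sepᶜ-bound (just u) nothing  = ≤-refl
  sepᶜ-bound (just u) (just v) = ℕ.m≤n⇒m≤1+n (sep-bound u v)

  sep-refl : ∀ {j} (u : Block j) → sep u u ≡ 0
  sepᶜ-refl : ∀ {j} (x : Cell j) → sepᶜ x x ≡ 0
  sep-refl (end false) = refl
  sep-refl (end true)  = refl
  sep-refl (a ▸ x)     = trans (sep-▸ a x x) (sepᶜ-refl x)
  sepᶜ-refl nothing  = refl
  sepᶜ-refl (just u) = sep-refl u

  sep-sym : ∀ {j} (u v : Block j) → sep u v ≡ sep v u
  sepᶜ-sym : ∀ {j} (x y : Cell j) → sepᶜ x y ≡ sepᶜ y x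
  sep-sym (end false) (end false) = refl
  sep-sym (end false) (end true)  = refl
  sep-sym (end true)  (end false) = refl
  sep-sym (end true)  (end true)  = refl
  sep-sym (a ▸ x) (b ▸ y) with a Fin.≟ b
  ... | yes refl = trans (sepᶜ-sym x y) (sym (sep-▸ a y x))
  ... | no  a≢b  = sym (sep-▸-≢ {x = y} {x} (a≢b ∘ sym))
  sepᶜ-sym nothing  nothing  = refl
  sepᶜ-sym nothing  (just v) = refl
  sepᶜ-sym (just u) nothing  = refl
  sepᶜ-sym (just u) (just v) = sep-sym u v

  sep≡0⇒≡ : ∀ {j} (u v : Block j) → sep u v ≡ 0 → u ≡ v
  sepᶜ≡0⇒≡ : ∀ {j} (x y : Cell j) → sepᶜ x y ≡ 0 → x ≡ y
  sep≡0⇒≡ (end false) (end false) _ = refl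
  sep≡0⇒≡ (end true)  (end true)  _ = refl
  sep≡0⇒≡ (a ▸ x) (b ▸ y) eq with a Fin.≟ b
  ... | yes refl = cong (a ▸_) (sepᶜ≡0⇒≡ x y eq)
  sepᶜ≡0⇒≡ nothing  nothing  _  = refl
  sepᶜ≡0⇒≡ (just u) (just v) eq = cong just (sep≡0⇒≡ u v eq)

  -- Two vertices that differ at the outermost step have the largest separation possible in their
  -- block, which by `sep-bound` dominates every other one. This makes `sep u v ≤ t` an equivalence
  -- for each t, and the resulting partitions are nested.
  sep-ultrametric : ∀ {j t} (u v w : Block j) → sep u v ≤ t → sep v w ≤ t → sep u w ≤ t
  sepᶜ-ultrametric : ∀ {j t} (x y z : Cell j) → sepᶜ x y ≤ t → sepᶜ y z ≤ t → sepᶜ x z ≤ t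
  sep-ultrametric (end false) (end false) (end _) _ q = q
  sep-ultrametric (end true)  (end true)  (end _) _ q = q
  sep-ultrametric u@(end false) (end true)  w@(end _) p _ = ≤-trans (sep-bound u w) p
  sep-ultrametric u@(end true)  (end false) w@(end _) p _ = ≤-trans (sep-bound u w) p
  sep-ultrametric (a ▸ x) (b ▸ y) (c ▸ z) p q with a Fin.≟ b
  ... | no  _ = ≤-trans (sep-bound (a ▸ x) (c ▸ z)) p
  ... | yes refl with a Fin.≟ c
  ...   | no  _    = q
  ...   | yes refl = sepᶜ-ultrametric x y z p q
  sepᶜ-ultrametric nothing  nothing  z        p q = q
  sepᶜ-ultrametric nothing  (just v) z        p q = ≤-trans (sepᶜ-bound nothing z) p
  sepᶜ-ultrametric (just u) nothing  z        p q = ≤-trans (sepᶜ-bound (just u) z) p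
  sepᶜ-ultrametric (just u) (just v) nothing  p q = q
  sepᶜ-ultrametric (just u) (just v) (just w) p q = sep-ultrametric u v w p q

  infix 4 _≟_ _≟ᶜ_
  _≟_ : ∀ {j} (u v : Block j) → Dec (u ≡ v)
  u ≟ v = map′ (sep≡0⇒≡ u v) (λ { refl → sep-refl u }) (sep u v ℕ.≟ 0)

  _≟ᶜ_ : ∀ {j} (x y : Cell j) → Dec (x ≡ y)
  x ≟ᶜ y = map′ (sepᶜ≡0⇒≡ x y) (λ { refl → sepᶜ-refl x }) (sepᶜ x y ℕ.≟ 0)

  infix 4 _↝?_ _↝ᶜ?_
  _↝?_ : ∀ {j} (u v : Block j) → Dec (u ↝ v)
  _↝ᶜ?_ : ∀ {j} (x y : Cell j) → Dec (x ↝ᶜ y)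
  end false ↝? end false = no λ ()
  end false ↝? end true  = yes pair
  end true  ↝? end _     = no λ ()
  _↝?_ {suc j} (a ▸ x) (b ▸ y) with x ↝ᶜ? y | a Fin.≟ b
  ... | yes x↝y | yes refl = yes (item x↝y)
  ... | no  x↝̸y | yes refl = no λ { (item x↝y) → x↝̸y x↝y ; (link e) → ℕ.1+n≢n (sym e) }
  ... | _ | no a≢b with toℕ b ℕ.≟ suc (toℕ a) | x ≟ᶜ just (out j) | y ≟ᶜ just (inn j)
  ...   | yes e | yes refl | yes refl = yes (link e)
  ...   | no ¬e | _ | _ = no λ { (item _) → a≢b refl ; (link e) → ¬e e }
  ...   | _ | no ¬e | _ = no λ { (item _) → a≢b refl ; (link e) → ¬e refl }
  ...   | _ | _ | no ¬e = no λ { (item _) → a≢b refl ; (link e) → ¬e refl }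
  nothing ↝ᶜ? nothing = no λ ()
  just u  ↝ᶜ? nothing = no λ ()
  just u  ↝ᶜ? just v  = map′ inside (λ { (inside p) → p }) (u ↝? v)
  _↝ᶜ?_ {j} nothing (just v) with v ≟ inn j | v ≟ out j
  ... | yes refl | _        = yes entry
  ... | no _     | yes refl = yes exit
  ... | no v≢inn | no v≢out = no λ { entry → v≢inn refl ; exit → v≢out refl }

  ↝-irrefl : ∀ {j} {u v : Block j} → u ↝ v → u ≢ v
  ↝ᶜ-irrefl : ∀ {j} {x y : Cell j} → x ↝ᶜ y → x ≢ y
  ↝-irrefl (item p) refl = ↝ᶜ-irrefl p refl
  ↝-irrefl (link e) eq = ℕ.1+n≢n (trans (sym e) (cong toℕ (sym (head-≡ eq))))
    where
    head-≡ : ∀ {j a b} {x y : Cell j} → a ▸ x ≡ b ▸ y → a ≡ b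
    head-≡ refl = refl
  ↝ᶜ-irrefl (inside p) refl = ↝-irrefl p refl

  inn≢out : ∀ j → inn j ≢ out j
  inn≢out zero    ()
  inn≢out (suc j) eq = inn≢out j (tail-≡ eq)
    where
    tail-≡ : ∀ {j a b} {u v : Block j} → a ▸ just u ≡ b ▸ just v → u ≡ v
    tail-≡ refl = refl

  size : ℕ → ℕ
  size zero    = 2
  size (suc j) = k * suc (size j)

  Maybe↔ : ∀ {n} {A : Set} → A ↔ Fin n → Maybe A ↔ Fin (suc n)
  Maybe↔ {n} {A} A↔n = mk↔ₛ′ f g
    (λ { fzero → refl ; (fsuc i) → cong fsuc (strictlyInverseˡ i) })
    (λ { nothing → refl ; (just a) → cong just (strictlyInverseʳ a) })
    where
    open Inverse A↔n
    f : Maybe A → Fin (suc n)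
    f nothing  = fzero
    f (just a) = fsuc (to a)
    g : Fin (suc n) → Maybe A
    g fzero    = nothing
    g (fsuc i) = just (from i)

  enumerate : ∀ j → Block j ↔ Fin (size j)
  enumerate zero = mk↔ₛ′
    (λ { (end false) → fzero ; (end true) → fsuc fzero })
    (λ { fzero → end false ; (fsuc fzero) → end true })
    (λ { fzero → refl ; (fsuc fzero) → refl })
    (λ { (end false) → refl ; (end true) → refl })
  enumerate (suc j) = mk↔ₛ′
    (λ { (a ▸ x) → combine a (to x) })
    (λ i → proj₁ (remQuot {k} n i) ▸ from (proj₂ (remQuot {k} n i)))
    (λ i → trans (cong (combine (proj₁ (remQuot {k} n i))) (strictlyInverseˡ _)) (Fin.combine-remQuot {k} n i))
    (λ { (a ▸ x) → cong₂ _▸_ (cong proj₁ (Fin.remQuot-combine a (to x)))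
                      (trans (cong (from ∘ proj₂) (Fin.remQuot-combine a (to x))) (strictlyInverseʳ x)) })
    where
    n = suc (size j)
    open Inverse (Maybe↔ (enumerate j))

  -- Numbers the clusters of level t inside one cluster of level t + 1 along the
  -- chain of items, so that an edge between two of them moves by at most 2.
  code : ∀ {j} → ℕ → Block j → ℕ
  codeᶜ : ∀ {j} → ℕ → Cell j → ℕ
  code         t (end b) = if t ≡ᵇ 0 then (if b then 1 else 0) else 0
  code {suc j} t (a ▸ x) = (if t ≡ᵇ suc j then 2 * toℕ a else 0) + codeᶜ t x
  codeᶜ {j} t nothing  = if t ≡ᵇ suc j then 1 else 0
  codeᶜ     t (just u) = code t u

  if-≢ : ∀ {t s} {a b : ℕ} → t ≢ s → (if t ≡ᵇ s then a else b) ≡ b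
  if-≢ {t} {s} t≢s with t ≡ᵇ s in eq
  ... | false = refl
  ... | true  = contradiction (ℕ.≡ᵇ⇒≡ t s (subst T (sym eq) tt)) t≢s

  if-≡ : ∀ t {a b : ℕ} → (if t ≡ᵇ t then a else b) ≡ a
  if-≡ t with t ≡ᵇ t in eq
  ... | true  = refl
  ... | false = contradiction (subst T eq (ℕ.≡⇒≡ᵇ t t refl)) λ ()

  -- For t > j the whole block lies inside one cluster of level t, so there is nothing to number.
  code≡0 : ∀ {j t} (u : Block j) → j < t → code t u ≡ 0
  codeᶜ≡0 : ∀ {j t} (x : Cell j) → suc j < t → codeᶜ t x ≡ 0
  code≡0 {t = suc t} (end _) _ = refl
  code≡0 (a ▸ x) j<t = cong₂ _+_ (if-≢ (ℕ.>⇒≢ j<t)) (codeᶜ≡0 x j<t)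
  codeᶜ≡0 nothing  j<t = if-≢ (ℕ.>⇒≢ j<t)
  codeᶜ≡0 (just u) j<t = code≡0 u (ℕ.<-trans (ℕ.n<1+n _) j<t)

  code-cong : ∀ {j t} (u v : Block j) → sep u v ≤ t → code t u ≡ code t v
  codeᶜ-cong : ∀ {j t} (x y : Cell j) → sepᶜ x y ≤ t → codeᶜ t x ≡ codeᶜ t y
  code-cong {t = zero} (end false) (end false) _ = refl
  code-cong {t = zero} (end true)  (end true)  _ = refl
  code-cong {t = suc t} (end _) (end _) _ = refl
  code-cong (a ▸ x) (b ▸ y) p with a Fin.≟ b
  ... | yes refl = cong (_ +_) (codeᶜ-cong x y p)
  ... | no  _    = trans (code≡0 (a ▸ x) p) (sym (code≡0 (b ▸ y) p))
  codeᶜ-cong nothing  nothing  p = refl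
  codeᶜ-cong (just u) (just v) p = code-cong u v p
  codeᶜ-cong nothing  (just v) p = trans (codeᶜ≡0 nothing p) (sym (codeᶜ≡0 (just v) p))
  codeᶜ-cong (just u) nothing  p = trans (codeᶜ≡0 (just u) p) (sym (codeᶜ≡0 nothing p))

  code-▸-just : ∀ {j} a (u : Block j) → code (suc j) (a ▸ just u) ≡ 2 * toℕ a
  code-▸-just {j} a u = trans (cong₂ _+_ (if-≡ j) (code≡0 u ≤-refl)) (ℕ.+-identityʳ (2 * toℕ a))

  -- At t = j + 1 the block of item a has number 2 a and its hub 2 a + 1; hub edges therefore change
  -- the number by 1 and links by 2.
  code-edge : ∀ {j t} {u v : Block j} → u ↝ v → sep u v ≡ suc t → ∣ code t u - code t v ∣ ≤ 2
  codeᶜ-edge : ∀ {j t} {x y : Cell j} → x ↝ᶜ y → sepᶜ x y ≡ suc t → ∣ codeᶜ t x - codeᶜ t y ∣ ≤ 2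
  code-edge pair refl = s≤s z≤n
  code-edge {suc j} {t} (item {a = a} {x} {y} p) eq = subst (_≤ 2)
    (sym (ℕ.∣m+n-m+o∣≡∣n-o∣ (if t ≡ᵇ suc j then 2 * toℕ a else 0) (codeᶜ t x) (codeᶜ t y)))
    (codeᶜ-edge p (trans (sym (sep-▸ a x y)) eq))
  code-edge {suc j} (link {a = a} {b} e) eq
    with refl ← ℕ.suc-injective (trans (sym (sep-▸-≢ {a = a} {b} {just (out j)} {just (inn j)} (λ { refl → ℕ.1+n≢n (sym e) }))) eq)
    = subst (_≤ 2) (sym codes) ≤-refl
    where
    open ≡.≡-Reasoning
    m = toℕ a
    codes : ∣ code (suc j) (a ▸ just (out j)) - code (suc j) (b ▸ just (inn j)) ∣ ≡ 2
    codes = begin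
      ∣ code (suc j) (a ▸ just (out j)) - code (suc j) (b ▸ just (inn j)) ∣
        ≡⟨ cong₂ ∣_-_∣ (code-▸-just a (out j)) (code-▸-just b (inn j)) ⟩
      ∣ 2 * m - 2 * toℕ b ∣      ≡⟨ cong (λ n → ∣ 2 * m - 2 * n ∣) e ⟩
      ∣ 2 * m - 2 * suc m ∣      ≡⟨ ℕ.*-distribˡ-∣-∣ 2 m (suc m) ⟨
      2 * ∣ m - suc m ∣          ≡⟨ cong (2 *_) (trans (cong ∣ m -_∣ (ℕ.+-comm 1 m)) (ℕ.∣m-m+n∣≡n m 1)) ⟩
      2                          ∎
  codeᶜ-edge {j} entry refl = subst (_≤ 2)
    (cong₂ ∣_-_∣ (sym (if-≡ j)) (sym (code≡0 (inn j) ≤-refl))) (s≤s z≤n)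
  codeᶜ-edge {j} exit refl = subst (_≤ 2)
    (cong₂ ∣_-_∣ (sym (if-≡ j)) (sym (code≡0 (out j) ≤-refl))) (s≤s z≤n)
  codeᶜ-edge (inside p) eq = code-edge p eq

  codeᶜ≤1 : ∀ {j} (x : Cell j) → codeᶜ (suc j) x ≤ 1
  codeᶜ≤1 {j} nothing  = ℕ.≤-reflexive (if-≡ j)
  codeᶜ≤1 {j} (just u) = subst (_≤ 1) (sym (code≡0 u ≤-refl)) z≤n

  2*-+-mono-< : ∀ {a b c} d → a < b → c ≤ 1 → 2 * a + c < 2 * b + d
  2*-+-mono-< {a} {b} {c} d a<b c≤1 = begin-strict
    2 * a + c <⟨ ℕ.+-monoʳ-< (2 * a) (s≤s c≤1) ⟩
    2 * a + 2 ≡⟨ trans (ℕ.+-comm (2 * a) 2) (sym (ℕ.*-suc 2 a)) ⟩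
    2 * suc a ≤⟨ ℕ.*-monoʳ-≤ 2 a<b ⟩
    2 * b     ≤⟨ ℕ.m≤m+n (2 * b) d ⟩
    2 * b + d ∎
    where open ℕ.≤-Reasoning

  2*-+-injective : ∀ {a b c d} → c ≤ 1 → d ≤ 1 → 2 * a + c ≡ 2 * b + d → a ≡ b
  2*-+-injective {a} {b} {c} {d} c≤1 d≤1 eq with ℕ.<-cmp a b
  ... | tri< a<b _ _ = contradiction eq (ℕ.<⇒≢ (2*-+-mono-< d a<b c≤1))
  ... | tri≈ _ a≡b _ = a≡b
  ... | tri> _ _ b<a = contradiction (sym eq) (ℕ.<⇒≢ (2*-+-mono-< c b<a d≤1))

  -- Inside one cluster of level t + 1 the number identifies the cluster of level t: halving
  -- recovers the item, and parity tells its hub from its block.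
  code-injective : ∀ {j t} (u v : Block j) → sep u v ≤ suc t → code t u ≡ code t v → sep u v ≤ t
  codeᶜ-injective : ∀ {j t} (x y : Cell j) → sepᶜ x y ≤ suc t → codeᶜ t x ≡ codeᶜ t y → sepᶜ x y ≤ t
  code-injective (end false) (end false) _ _ = z≤n
  code-injective (end true)  (end true)  _ _ = z≤n
  code-injective {t = suc t} u@(end _) v@(end _) _ _ = ≤-trans (sep-bound u v) (s≤s z≤n)
  code-injective {suc j} {t} (a ▸ x) (b ▸ y) p eq with a Fin.≟ b
  ... | yes refl = codeᶜ-injective x y p (ℕ.+-cancelˡ-≡ _ _ _ eq)
  ... | no  a≢b with ℕ.m≤n⇒m<n∨m≡n p
  ...   | inj₁ (s≤s j<t) = j<t
  ...   | inj₂ refl = contradiction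
          (Fin.toℕ-injective (2*-+-injective (codeᶜ≤1 x) (codeᶜ≤1 y)
            (subst₂ (λ m n → m + codeᶜ (suc j) x ≡ n + codeᶜ (suc j) y) (if-≡ j) (if-≡ j) eq))) a≢b
  codeᶜ-injective nothing  nothing  _ _  = z≤n
  codeᶜ-injective (just u) (just v) p eq = code-injective u v p eq
  codeᶜ-injective {j} nothing (just v) p eq with ℕ.m≤n⇒m<n∨m≡n p
  ... | inj₁ (s≤s j<t) = j<t
  ... | inj₂ refl = contradiction (trans (sym (if-≡ j)) (trans eq (code≡0 v ≤-refl))) λ ()
  codeᶜ-injective {j} (just u) nothing p eq with ℕ.m≤n⇒m<n∨m≡n p
  ... | inj₁ (s≤s j<t) = j<t
  ... | inj₂ refl = contradiction (trans (sym (if-≡ j)) (trans (sym eq) (code≡0 u ≤-refl))) λ ()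

  -- Base pairs, and cuts that isolate one of them.

  -- The index is read as j digits in base k, the items chosen on the way down; indexing by
  -- `Fin (k ^ j)` makes the number of pairs explicit.
  leaf : ∀ j → Fin (k ^ j) → Bool → Block j
  leaf zero    _ b = end b
  leaf (suc j) i b = proj₁ (remQuot {k} (k ^ j) i) ▸ just (leaf j (proj₂ (remQuot {k} (k ^ j) i)) b)

  leaf-injective : ∀ j {i i′ b b′} → leaf j i b ≡ leaf j i′ b′ → i ≡ i′ × b ≡ b′
  leaf-injective zero {fzero} {fzero} refl = refl , refl
  leaf-injective (suc j) {i} {i′} eq = i≡i′ , proj₂ rec
    where
    ▸-injective : ∀ {j a b} {u v : Block j} → a ▸ just u ≡ b ▸ just v → a ≡ b × u ≡ v
    ▸-injective refl = refl , refl
    rec = leaf-injective j (proj₂ (▸-injective eq))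
    i≡i′ : i ≡ i′
    i≡i′ = trans (sym (Fin.combine-remQuot {k} (k ^ j) i))
      (trans (cong₂ combine (proj₁ (▸-injective eq)) (proj₁ rec)) (Fin.combine-remQuot {k} (k ^ j) i′))

  -- Witnesses that pair `i` is the only edge of `E` across a cut between entrance and exit, so
  -- every walk in `E` from one to the other uses it.
  record Cut {j} (E : Block j → Block j → Bool) (i : Fin (k ^ j)) : Set where
    field
      χ      : Block j → Bool
      χ-inn  : χ (inn j) ≡ false
      χ-out  : χ (out j) ≡ true
      χ-edge : ∀ {u v} → u ↝ v → T (E u v) →
               χ u ≡ χ v ⊎ (u ≡ leaf j i false × v ≡ leaf j i true)

  record Cutᶜ {j} (E : Cell j → Cell j → Bool) (i : Fin (k ^ j)) : Set where
    field
      χ      : Cell j → Bool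
      χ-inn  : χ (just (inn j)) ≡ false
      χ-out  : χ (just (out j)) ≡ true
      χ-edge : ∀ {x y} → x ↝ᶜ y → T (E x y) →
               χ x ≡ χ y ⊎ (x ≡ just (leaf j i false) × y ≡ just (leaf j i true))

  -- The condition `s p q < s z p` says that some cluster contains p and q but not z.
  AtMostOneEdgeTo : ∀ {A : Set} (E : A → A → Bool) (s : A → A → ℕ) → Set
  AtMostOneEdgeTo E s = ∀ z p q → T (E z p) → T (E z q) → s p q < s z p → p ≡ q

  module _ {j} (a₀ : Fin k) (χ₀ : Cell j → Bool) where

    -- Extends a colouring of item `a₀` to the chain so that no link becomes bichromatic: everything
    -- before it gets the colour of its entrance, everything after it that of its exit.
    place : Block (suc j) → Bool
    place (a ▸ x) with Fin.<-cmp a a₀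
    ... | tri< _ _ _ = false
    ... | tri≈ _ _ _ = χ₀ x
    ... | tri> _ _ _ = true

    place-< : ∀ {a x} → toℕ a < toℕ a₀ → place (a ▸ x) ≡ false
    place-< {a} a<a₀ with Fin.<-cmp a a₀
    ... | tri< _ _ _ = refl
    ... | tri≈ a≮a₀ _ _ = contradiction a<a₀ a≮a₀
    ... | tri> a≮a₀ _ _ = contradiction a<a₀ a≮a₀

    place-> : ∀ {a x} → toℕ a₀ < toℕ a → place (a ▸ x) ≡ true
    place-> {a} a>a₀ with Fin.<-cmp a a₀
    ... | tri< _ _ a≯a₀ = contradiction a>a₀ a≯a₀
    ... | tri≈ _ _ a≯a₀ = contradiction a>a₀ a≯a₀
    ... | tri> _ _ _ = refl

    place-≡ : ∀ {x} → place (a₀ ▸ x) ≡ χ₀ x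
    place-≡ with Fin.<-cmp a₀ a₀
    ... | tri< _ a₀≢a₀ _ = contradiction refl a₀≢a₀
    ... | tri≈ _ _ _ = refl
    ... | tri> _ a₀≢a₀ _ = contradiction refl a₀≢a₀

    place-inn : χ₀ (just (inn j)) ≡ false → ∀ {a} → toℕ a ≤ toℕ a₀ →
                place (a ▸ just (inn j)) ≡ false
    place-inn χ₀-inn a≤a₀ with ℕ.m≤n⇒m<n∨m≡n a≤a₀
    ... | inj₁ a<a₀ = place-< a<a₀
    ... | inj₂ a≡a₀ rewrite Fin.toℕ-injective a≡a₀ = trans place-≡ χ₀-inn

    place-out : χ₀ (just (out j)) ≡ true → ∀ {a} → toℕ a₀ ≤ toℕ a →
                place (a ▸ just (out j)) ≡ true
    place-out χ₀-out a₀≤a with ℕ.m≤n⇒m<n∨m≡n a₀≤a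
    ... | inj₁ a₀<a = place-> a₀<a
    ... | inj₂ a₀≡a rewrite sym (Fin.toℕ-injective a₀≡a) = trans place-≡ χ₀-out

  -- Recursion on the digits of `i`: only the item containing the pair needs a cut of its own, and
  -- there the hub, which could bypass the pair, is harmless because `E` joins it to one end at
  -- most.
  cut : ∀ {j} (E : Block j → Block j → Bool) → AtMostOneEdgeTo E sep → ∀ i → Cut E i
  cutᶜ : ∀ {j} (E : Cell j → Cell j → Bool) → AtMostOneEdgeTo E sepᶜ → ∀ i → Cutᶜ E i
  cut {zero} E one i = record
    { χ      = λ { (end b) → b }
    ; χ-inn  = refl
    ; χ-out  = refl
    ; χ-edge = λ { pair _ → inj₂ (refl , refl) }
    }
  cut {suc j} E one i = record
    { χ      = place a₀ χ₀
    ; χ-inn  = place-inn a₀ χ₀ χ-inn z≤n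
    ; χ-out  = place-out a₀ χ₀ χ-out (subst (toℕ a₀ ≤_) (sym (Fin.toℕ-fromℕ k′)) (Fin.toℕ≤pred[n] a₀))
    ; χ-edge = edge
    }
    where
    a₀ = proj₁ (remQuot {k} (k ^ j) i)
    E₀ : Cell j → Cell j → Bool
    E₀ x y = E (a₀ ▸ x) (a₀ ▸ y)
    ▸-tail : ∀ {a} {x y : Cell j} → a ▸ x ≡ a ▸ y → x ≡ y
    ▸-tail refl = refl
    one₀ : AtMostOneEdgeTo E₀ sepᶜ
    one₀ z p q ezp ezq lt = ▸-tail (one (a₀ ▸ z) (a₀ ▸ p) (a₀ ▸ q) ezp ezq
      (subst₂ _<_ (sym (sep-▸ a₀ p q)) (sym (sep-▸ a₀ z p)) lt))
    open Cutᶜ (cutᶜ E₀ one₀ (proj₂ (remQuot {k} (k ^ j) i))) renaming (χ to χ₀)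
    edge : ∀ {u v} → u ↝ v → T (E u v) →
           place a₀ χ₀ u ≡ place a₀ χ₀ v ⊎ (u ≡ leaf (suc j) i false × v ≡ leaf (suc j) i true)
    edge (item {a = a} {x} {y} p) e with Fin.<-cmp a a₀
    ... | tri< _ _ _ = inj₁ refl
    ... | tri> _ _ _ = inj₁ refl
    ... | tri≈ _ refl _ = Sum.map₂ (λ (p , q) → cong (a₀ ▸_) p , cong (a₀ ▸_) q) (χ-edge p e)
    edge (link {a = a} {b} b≡1+a) e with ℕ.<-≤-connex (toℕ a) (toℕ a₀)
    ... | inj₁ a<a₀ = inj₁ (trans (place-< a₀ χ₀ a<a₀)
                        (sym (place-inn a₀ χ₀ χ-inn (subst (_≤ toℕ a₀) (sym b≡1+a) a<a₀))))
    ... | inj₂ a₀≤a = inj₁ (trans (place-out a₀ χ₀ χ-out a₀≤a)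
                        (sym (place-> a₀ χ₀ (subst (toℕ a₀ <_) (sym b≡1+a) (s≤s a₀≤a)))))
  cutᶜ {j} E one i = record
    { χ      = χᶜ
    ; χ-inn  = χ-inn
    ; χ-out  = χ-out
    ; χ-edge = edge
    }
    where
    open Cut (cut (λ u v → E (just u) (just v))
      (λ z p q ezp ezq lt → just-injective (one (just z) (just p) (just q) ezp ezq lt)) i) renaming (χ to χ₀)
    χᶜ : Cell j → Bool
    -- The hub is coloured `false`, like the entrance, exactly when `E` joins it to the entrance.
    -- Otherwise it is `true`, which agrees with the exit if `E` joins it there.
    χᶜ nothing  = not (E nothing (just (inn j)))
    χᶜ (just u) = χ₀ u
    hub-not-both : T (E nothing (just (out j))) → E nothing (just (inn j)) ≡ false
    hub-not-both e-out with E nothing (just (inn j)) in eq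
    ... | false = refl
    ... | true  = contradiction
      (just-injective (one nothing (just (inn j)) (just (out j)) (subst T (sym eq) tt) e-out (s≤s (sep-bound (inn j) (out j)))))
      (inn≢out j)
    edge : ∀ {x y} → x ↝ᶜ y → T (E x y) →
           χᶜ x ≡ χᶜ y ⊎ (x ≡ just (leaf j i false) × y ≡ just (leaf j i true))
    edge entry e = inj₁ (trans (cong not (Equivalence.to T-≡ e)) (sym χ-inn))
    edge exit  e = inj₁ (trans (cong not (hub-not-both e)) (sym χ-out))
    edge (inside p) e = Sum.map₂ (λ (p , q) → cong just p , cong just q) (χ-edge p e)

-- Walks, simple paths and their cuts.

bichromaticStep : ∀ {a ℓ} {A : Set a} {R : A → A → Set ℓ} (χ : A → Bool) {u v} →
                  Star R u v → χ u ≢ χ v → ∃[ x ] ∃[ y ] R x y × χ x ≢ χ y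
bichromaticStep χ ε χu≢χv = contradiction ≡.refl χu≢χv
bichromaticStep χ {u} (_◅_ {j = x} r rs) χu≢χv with χ u ≟ᵇ χ x
... | yes χu≡χx = bichromaticStep χ rs (χu≢χv ∘ ≡.trans χu≡χx)
... | no  χu≢χx = u , x , r , χu≢χx

module SimplePaths {A : Set} where

  -- Path R u v xs is a walk from u to v through the vertices u ∷ xs.
  data Path {ℓ} (R : A → A → Set ℓ) : A → A → List A → Set ℓ where
    []  : ∀ {u} → Path R u u []
    _∷_ : ∀ {u x v xs} → R u x → Path R x v xs → Path R u v (x ∷ xs)

  module _ {ℓ} {R : A → A → Set ℓ} where

    suffix : ∀ {u v w xs} → Path R u v xs → Unique (u ∷ xs) → w ∈ u ∷ xs →
             ∃[ ys ] Path R w v ys × Unique (w ∷ ys)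
    suffix p        uniq       (here ≡.refl) = _ , p , uniq
    suffix (_ ∷ p) (_ ∷ uniq) (there w∈)    = suffix p uniq w∈

    -- Loop erasure from the far end: if `u` occurs again, the simple path found so far is shortened
    -- to its suffix from `u`.
    simplify : DecidableEquality A → ∀ {u v} → Star R u v → ∃[ xs ] Path R u v xs × Unique (u ∷ xs)
    simplify _≟_ ε = [] , [] , [] ∷ []
    simplify _≟_ {u} (_◅_ {j = x} r rs) with simplify _≟_ rs
    ... | xs , p , uniq with any? (u ≟_) (x ∷ xs)
    ...   | yes u∈ = suffix p uniq u∈
    ...   | no  u∉ = x ∷ xs , r ∷ p , All.¬Any⇒All¬ _ u∉ ∷ uniq

    path-linked : ∀ {u v w xs} → Path R u v xs → R v w → Linked R (u ∷ (xs ∷ʳ w))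
    path-linked []      r = r ∷ [-]
    path-linked (s ∷ p) r = s ∷ path-linked p r

    path-end∈ : ∀ {u v xs} → Path R u v xs → v ∈ u ∷ xs
    path-end∈ []      = here ≡.refl
    path-end∈ (_ ∷ p) = there (path-end∈ p)

    path-all : ∀ {p} {P : A → Set p} {u v xs} → (∀ {x y} → R x y → P y) → Path R u v xs → All P xs
    path-all f []      = []
    path-all f (r ∷ p) = f r ∷ path-all f p

  data Consecutive (a b : A) : List A → Set where
    here  : ∀ {xs} → Consecutive a b (a ∷ b ∷ xs)
    there : ∀ {x xs} → Consecutive a b xs → Consecutive a b (x ∷ xs)

  consecutive? : DecidableEquality A → ∀ a b xs → Dec (Consecutive a b xs)
  consecutive? _≟_ a b []       = no λ ()
  consecutive? _≟_ a b (x ∷ []) = no λ { (there ()) }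
  consecutive? _≟_ a b (x ∷ y ∷ xs) with consecutive? _≟_ a b (y ∷ xs) | a ≟ x | b ≟ y
  ... | yes c | _ | _ = yes (there c)
  ... | no _  | yes ≡.refl | yes ≡.refl = yes here
  ... | no ¬c | no a≢x | _ = no λ { here → a≢x ≡.refl ; (there c) → ¬c c }
  ... | no ¬c | _ | no b≢y = no λ { here → b≢y ≡.refl ; (there c) → ¬c c }

  consecutive-∈ˡ : ∀ {a b xs} → Consecutive a b xs → a ∈ xs
  consecutive-∈ˡ here      = here ≡.refl
  consecutive-∈ˡ (there c) = there (consecutive-∈ˡ c)

  consecutive-∈ʳ : ∀ {a b xs} → Consecutive a b xs → b ∈ xs
  consecutive-∈ʳ here      = there (here ≡.refl)
  consecutive-∈ʳ (there c) = there (consecutive-∈ʳ c)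

  -- A path with two or more vertices has an edge at each of them, so membership of vertices can be
  -- deduced from that of edges.
  ∈⇒consecutive : ∀ {w x y} xs → w ∈ x ∷ y ∷ xs →
                  ∃[ z ] (Consecutive w z (x ∷ y ∷ xs) ⊎ Consecutive z w (x ∷ y ∷ xs))
  ∈⇒consecutive xs (here ≡.refl) = _ , inj₁ here
  ∈⇒consecutive xs (there (here ≡.refl)) = _ , inj₂ here
  ∈⇒consecutive (z ∷ xs) (there w∈) with ∈⇒consecutive xs w∈
  ... | _ , inj₁ c = _ , inj₁ (there c)
  ... | _ , inj₂ c = _ , inj₂ (there c)

  module _ {ℓ} {R : A → A → Set ℓ} where

    path-consecutive : ∀ {a b u v xs} → Path R u v xs → Consecutive a b (u ∷ xs) → R a b
    path-consecutive (r ∷ p) here      = r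
    path-consecutive (r ∷ p) (there c) = path-consecutive p c

    path-reach : ∀ {u v w xs} → Path R u v xs → w ∈ u ∷ xs →
                 Star (λ a b → Consecutive a b (u ∷ xs)) u w
    path-reach p       (here ≡.refl) = ε
    path-reach (r ∷ p) (there w∈)    = here ◅ Star.map there (path-reach p w∈)

    -- Each edge of a simple path is a bridge of it: χ marks the vertices up to `a`, and since no
    -- vertex recurs no other edge of the path leaves this set.
    path-cut : DecidableEquality A → ∀ {a b u v xs} → Path R u v xs → Unique (u ∷ xs) → Consecutive a b (u ∷ xs) →
               Σ[ χ ∈ (A → Bool) ] χ u ≡ true × χ v ≡ false ×
                 (∀ {c d} → Consecutive c d (u ∷ xs) → χ c ≡ χ d ⊎ (c ≡ a × d ≡ b))
    path-cut _≟_ {u = u} {v} {xs} (_∷_ {x = x} r p) (u∉ ∷ uniq) here =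
      χ , χ-≡ , χ-≢ (path-end∈ p) , χ-edge
      where
      χ : A → Bool
      χ w = ⌊ w ≟ u ⌋
      χ-≡ : χ u ≡ true
      χ-≡ with u ≟ u
      ... | yes _ = ≡.refl
      ... | no u≢u = contradiction ≡.refl u≢u
      χ-≢ : ∀ {w} → w ∈ xs → χ w ≡ false
      χ-≢ {w} w∈ with w ≟ u
      ... | yes ≡.refl = contradiction ≡.refl (All.lookup u∉ w∈)
      ... | no _ = ≡.refl
      χ-edge : ∀ {c d} → Consecutive c d (u ∷ xs) → χ c ≡ χ d ⊎ (c ≡ u × d ≡ x)
      χ-edge here      = inj₂ (≡.refl , ≡.refl)
      χ-edge (there c) = inj₁ (≡.trans (χ-≢ (consecutive-∈ˡ c)) (≡.sym (χ-≢ (consecutive-∈ʳ c))))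
    path-cut _≟_ {a} {b} {u} {v} {xs} (_∷_ {x = x} r p) (u∉ ∷ uniq) (there c)
      with path-cut _≟_ p uniq c
    ... | χ₀ , χ₀-x , χ₀-v , χ₀-edge = χ , χ-≡ , ≡.trans (χ-≢ (path-end∈ p)) χ₀-v , χ-edge
      where
      χ : A → Bool
      χ w = ⌊ w ≟ u ⌋ ∨ χ₀ w
      χ-≡ : χ u ≡ true
      χ-≡ with u ≟ u
      ... | yes _ = ≡.refl
      ... | no u≢u = contradiction ≡.refl u≢u
      χ-≢ : ∀ {w} → w ∈ xs → χ w ≡ χ₀ w
      χ-≢ {w} w∈ with w ≟ u
      ... | yes ≡.refl = contradiction ≡.refl (All.lookup u∉ w∈)
      ... | no _ = ≡.refl
      χ-edge : ∀ {c d} → Consecutive c d (u ∷ xs) → χ c ≡ χ d ⊎ (c ≡ a × d ≡ b)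
      χ-edge here      = inj₁ (≡.trans χ-≡ (≡.sym (≡.trans (χ-≢ (here ≡.refl)) χ₀-x)))
      χ-edge (there c) = Sum.map₁
        (λ eq → ≡.trans (χ-≢ (consecutive-∈ˡ c)) (≡.trans eq (≡.sym (χ-≢ (consecutive-∈ʳ c)))))
        (χ₀-edge c)

-- Finite sums of nonnegative terms.

module SumProperties {c ℓ₁ ℓ₂} (F : ArchimedeanOrderedField c ℓ₁ ℓ₂) where

  open ArchimedeanOrderedField F
  open OrderedFieldProperties F
  open Sums +-commutativeMonoid using (sum; sum-remove; sum-cong-≋; sum-replicate-zero)

  sum-nonneg : ∀ {n} (t : Fin n → Carrier) → (∀ i → 0# ≤ t i) → 0# ≤ sum t
  sum-nonneg {zero}  t 0≤t = ≤-refl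
  sum-nonneg {suc n} t 0≤t = 0≤+ (0≤t fzero) (sum-nonneg (t ∘ fsuc) (0≤t ∘ fsuc))

  sum-zero : ∀ {n} (t : Fin n → Carrier) → (∀ i → t i ≈ 0#) → sum t ≈ 0#
  sum-zero {n} t t≈0 = trans (sum-cong-≋ {n} t≈0) (sum-replicate-zero n)

  sum-single : ∀ {n} (t : Fin n → Carrier) a → (∀ i → i ≢ a → t i ≈ 0#) → sum t ≈ t a
  sum-single {suc n} t a t≈0 = trans (sum-remove {i = a} t)
    (trans (+-congˡ (sum-zero _ λ i → t≈0 (punchIn a i) (Fin.punchInᵢ≢i a i))) (+-identityʳ _))

  -- Induction on `B`: the term at `f fzero` is split off, and by injectivity `punchOut` carries the
  -- other indices into the remaining sum.
  sum-≥-multiple : ∀ {B n} w (t : Fin n → Carrier) (f : Fin B → Fin n) →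
                   (∀ i → 0# ≤ t i) → (∀ {b b′} → f b ≡ f b′ → b ≡ b′) →
                   (∀ b → w ≤ t (f b)) → fromℕ B * w ≤ sum t
  sum-≥-multiple {zero}  w t f 0≤t f-inj w≤ = ≤-trans (≤-reflexive (zeroˡ w)) (sum-nonneg t 0≤t)
  sum-≥-multiple {suc B} {zero} w t f 0≤t f-inj w≤ with () ← f fzero
  sum-≥-multiple {suc B} {suc n} w t f 0≤t f-inj w≤ = begin
    (1# + fromℕ B) * w             ≈⟨ distribʳ w 1# (fromℕ B) ⟩
    1# * w + fromℕ B * w           ≈⟨ +-congʳ (*-identityˡ w) ⟩
    w + fromℕ B * w                ≤⟨ +-mono-≤ (w≤ fzero) (sum-≥-multiple w (t ∘ punchIn a) g (0≤t ∘ punchIn a) g-inj w≤′) ⟩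
    t a + sum (t ∘ punchIn a)      ≈⟨ sum-remove {i = a} t ⟨
    sum t                          ∎
    where
    open ≤-Reasoning
    a = f fzero
    a≢ : ∀ b → a ≢ f (fsuc b)
    a≢ b eq with () ← f-inj eq
    g : Fin B → Fin n
    g b = punchOut (a≢ b)
    g-inj : ∀ {b b′} → g b ≡ g b′ → b ≡ b′
    g-inj eq = Fin.suc-injective (f-inj (Fin.punchOut-injective (a≢ _) (a≢ _) eq))
    w≤′ : ∀ b → w ≤ t (punchIn a (g b))
    w≤′ b = subst (λ i → w ≤ t i) (≡.sym (Fin.punchIn-punchOut (a≢ b))) (w≤ (fsuc b))

  entry-≥ : ∀ {w x} b → T b → w ≤ x → w ≤ (if b then x else 0#)
  entry-≥ true _ w≤x = w≤x

  entry-nonneg : ∀ {x} b → (T b → 0# ≤ x) → 0# ≤ (if b then x else 0#)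
  entry-nonneg true  0≤x = 0≤x tt
  entry-nonneg false 0≤x = ≤-refl

  entry-zero : ∀ {x} b → ¬ T b → (if b then x else 0#) ≈ 0#
  entry-zero true  ¬b = contradiction tt ¬b
  entry-zero false ¬b = refl

-- Trees, minimal subtrees and costs in an arbitrary graph.

module GraphProperties {c ℓ₁ ℓ₂} (F : ArchimedeanOrderedField c ℓ₁ ℓ₂) (G : Steiner.Graph F) where

  open ArchimedeanOrderedField F
  open OrderedFieldProperties F
  open SumProperties F
  open Steiner F
  open Graph G
  open Subgraph
  open Inverse enum using (to; from; strictlyInverseˡ; strictlyInverseʳ)

  abstract
    _≟ⱽ_ : DecidableEquality V
    u ≟ⱽ v = map′ (λ eq → ≡.trans (≡.sym (strictlyInverseʳ u)) (≡.trans (cong from eq) (strictlyInverseʳ v)))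
                 (cong to) (to u Fin.≟ to v)

  open SimplePaths

  adj⇒≢ : ∀ {u v} → T (adj u v) → u ≢ v
  adj⇒≢ {u} uv ≡.refl = subst T (adj-irrefl u) uv

  edge-flip : (S : Subgraph G) → ∀ {u v} → T (edge S u v) → T (edge S v u)
  edge-flip S {u} {v} = subst T (edge-sym S u v)

  adj-flip : ∀ {u v} → T (adj u v) → T (adj v u)
  adj-flip {u} {v} = subst T (adj-sym u v)

  0≤len : ∀ {u v} → T (adj u v) → 0# ≤ len u v
  0≤len uv = ≤-trans 0≤1 (1≤len _ _ uv)

  walkLength-nonneg : ∀ {R : V → V → Set} → (∀ {u v} → R u v → T (adj u v)) →
                      ∀ {u v} (ws : Star R u v) → 0# ≤ walkLength G ws
  walkLength-nonneg R⇒adj ε        = ≤-refl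
  walkLength-nonneg R⇒adj (r ◅ rs) = 0≤+ (0≤len (R⇒adj r)) (walkLength-nonneg R⇒adj rs)

  -- Two different neighbours of `z` in a connected set avoiding `z` would be joined by a simple
  -- path inside the set, which closes to a cycle through `z`.
  acyclic⇒unique-neighbour :
    ∀ {S} → (∀ v vs → ¬ IsCycle G S v vs) → (C : V → Set) → ∀ {z p q} → ¬ C z → C p →
    T (edge S z p) → T (edge S z q) →
    Star (λ x y → T (edge S x y) × C x × C y) p q → p ≡ q
  acyclic⇒unique-neighbour {S} acyclic C {z} {p} {q} z∉C p∈C zp zq ws
    with simplify _≟ⱽ_ ws
  ... | [] , [] , _ = ≡.refl
  ... | x ∷ xs , path , uniq = contradiction
      ( All.map (λ w∈C → λ { ≡.refl → z∉C w∈C }) (p∈C ∷ path-all (proj₂ ∘ proj₂) path) ∷ uniq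
      , s≤s (s≤s z≤n)
      , zp ∷ path-linked (forget path) (edge-flip S zq) )
      (acyclic z (p ∷ x ∷ xs))
    where
    forget : ∀ {u v ys} → Path (λ x y → T (edge S x y) × C x × C y) u v ys → Path (λ x y → T (edge S x y)) u v ys
    forget []            = []
    forget ((e , _) ∷ p) = e ∷ forget p

  pathSubgraph : ∀ {u v xs} → Path (λ x y → T (adj x y)) u v xs → Subgraph G
  pathSubgraph {u} {v} {xs} path = record
    { vtx      = λ w → ⌊ any? (w ≟ⱽ_) L ⌋
    ; edge     = λ a b → ⌊ consecutive? _≟ⱽ_ a b L ⌋ ∨ ⌊ consecutive? _≟ⱽ_ b a L ⌋
    ; edge-sym = λ a b → ∨-comm ⌊ consecutive? _≟ⱽ_ a b L ⌋ _
    ; edge⇒adj = λ a b e → case₁ (Equivalence.to (T-∨ {⌊ consecutive? _≟ⱽ_ a b L ⌋}) e)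
    ; edge⇒vtx = λ a b e → case₂ (Equivalence.to (T-∨ {⌊ consecutive? _≟ⱽ_ a b L ⌋}) e)
    }
    where
    L = u ∷ xs
    case₁ : ∀ {a b} → T ⌊ consecutive? _≟ⱽ_ a b L ⌋ ⊎ T ⌊ consecutive? _≟ⱽ_ b a L ⌋ → T (adj a b)
    case₁ (inj₁ c) = path-consecutive path (toWitness c)
    case₁ (inj₂ c) = adj-flip (path-consecutive path (toWitness c))
    case₂ : ∀ {a b} → T ⌊ consecutive? _≟ⱽ_ a b L ⌋ ⊎ T ⌊ consecutive? _≟ⱽ_ b a L ⌋ → T ⌊ any? (a ≟ⱽ_) L ⌋
    case₂ (inj₁ c) = fromWitness (consecutive-∈ˡ (toWitness c))
    case₂ (inj₂ c) = fromWitness (consecutive-∈ʳ (toWitness c))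

  module _ {u v xs} (path : Path (λ x y → T (adj x y)) u v xs) where

    private S = pathSubgraph path

    pathSubgraph-edge⁻ : ∀ {a b} → T (edge S a b) → Consecutive a b (u ∷ xs) ⊎ Consecutive b a (u ∷ xs)
    pathSubgraph-edge⁻ {a} {b} e = Sum.map toWitness toWitness
      (Equivalence.to (T-∨ {⌊ consecutive? _≟ⱽ_ a b (u ∷ xs) ⌋}) e)

    pathSubgraph-edge⁺ : ∀ {a b} → Consecutive a b (u ∷ xs) → T (edge S a b)
    pathSubgraph-edge⁺ {a} {b} c = Equivalence.from (T-∨ {⌊ consecutive? _≟ⱽ_ a b (u ∷ xs) ⌋}) (inj₁ (fromWitness c))

    pathSubgraph-vtx⁺ : ∀ {w} → w ∈ u ∷ xs → T (vtx S w)
    pathSubgraph-vtx⁺ = fromWitness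

    pathSubgraph-isTree : (∀ w ws → ¬ IsCycle G S w ws) → IsTree G S
    pathSubgraph-isTree acyclic = record
      { nonempty      = u , pathSubgraph-vtx⁺ (here ≡.refl)
      ; treeConnected = λ a b a∈ b∈ →
          Star.reverse (edge-flip S) (reach (toWitness a∈)) ◅◅ reach (toWitness b∈)
      ; acyclic       = acyclic
      }
      where
      reach : ∀ {w} → w ∈ u ∷ xs → Star (λ x y → T (edge S x y)) u w
      reach w∈ = Star.map pathSubgraph-edge⁺ (path-reach path w∈)

  module _ (r : V) where

    only : V → V → Bool
    only v w = ⌊ w ≟ⱽ v ⌋

    singleton-nontrivial : ∀ {v} → v ≢ r → Nontrivial G r (only v)
    singleton-nontrivial {v} v≢r = v , fromWitness ≡.refl , v≢r

    steinerTree-only : ∀ {S v} → IsTree G S → T (vtx S r) → T (vtx S v) → SteinerTree G r (only v) S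
    steinerTree-only {S} isTree r∈ v∈ = record
      { isTree = isTree ; containsRoot = r∈
      ; containsX = λ w w∈ → subst (T ∘ vtx S) (≡.sym (toWitness w∈)) v∈ }

    steinerWalk : ∀ {S v} → SteinerTree G r (only v) S → Star (λ x y → T (edge S x y)) r v
    steinerWalk st = treeConnected r _ containsRoot (containsX _ (fromWitness ≡.refl))
      where
      open SteinerTree st
      open IsTree isTree

    -- The simple path of τ from the root to `v` serves. It is minimal because a subtree with both
    -- ends must cross the cut of `path-cut` for each edge of the path, and within the path only
    -- that edge crosses it.
    minimalSubtree : ∀ τ {v} → IsTree G τ → T (vtx τ r) → T (vtx τ v) → v ≢ r →
                     ∃[ S ] IsMinimalSubtree G r τ (only v) S
    minimalSubtree τ {v} isTree r∈ v∈ v≢r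
      with simplify _≟ⱽ_ (IsTree.treeConnected isTree r v r∈ v∈)
    ... | [] , [] , _ = contradiction ≡.refl v≢r
    ... | x ∷ xs , path , uniq = S , S⊑τ
      , steinerTree-only tree (pathSubgraph-vtx⁺ pathᴳ (here ≡.refl)) (pathSubgraph-vtx⁺ pathᴳ (path-end∈ path))
      , minimal
      where
      L = r ∷ x ∷ xs
      weaken : ∀ {a b ys} → Path (λ x y → T (edge τ x y)) a b ys → Path (λ x y → T (adj x y)) a b ys
      weaken []      = []
      weaken (e ∷ p) = edge⇒adj τ _ _ e ∷ weaken p
      pathᴳ = weaken path
      S = pathSubgraph pathᴳ
      edge-⊑τ : ∀ a b → T (edge S a b) → T (edge τ a b)
      edge-⊑τ a b e with pathSubgraph-edge⁻ pathᴳ e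
      ... | inj₁ c = path-consecutive path c
      ... | inj₂ c = edge-flip τ (path-consecutive path c)
      S⊑τ : _⊑_ G S τ
      S⊑τ = record
        { vtx-⊑  = λ w w∈ → vtx-τ w (∈⇒consecutive xs (toWitness w∈))
        ; edge-⊑ = edge-⊑τ
        }
        where
        vtx-τ : ∀ w → ∃[ z ] (Consecutive w z L ⊎ Consecutive z w L) → T (vtx τ w)
        vtx-τ w (z , inj₁ c) = edge⇒vtx τ w z (path-consecutive path c)
        vtx-τ w (z , inj₂ c) = edge⇒vtx τ w z (edge-flip τ (path-consecutive path c))
      tree = pathSubgraph-isTree pathᴳ λ w ws (uniq , long , linked) →
        IsTree.acyclic isTree w ws (uniq , long , Linked.map (λ {a} {b} → edge-⊑τ a b) linked)
      minimal : ∀ S′ → _⊑_ G S′ S → SteinerTree G r (only v) S′ → _⊑_ G S S′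
      minimal S′ S′⊑S st = record
        { vtx-⊑  = λ w w∈ → vtx-S′ w (∈⇒consecutive xs (toWitness w∈))
        ; edge-⊑ = λ a b e → edge-S′ (pathSubgraph-edge⁻ pathᴳ e)
        }
        where
        open _⊑_ S′⊑S using (edge-⊑)
        consecutive-S′ : ∀ {a b} → Consecutive a b L → T (edge S′ a b)
        consecutive-S′ {a} {b} c with path-cut _≟ⱽ_ path uniq c
        ... | χ , χ-r , χ-v , χ-edge
          with bichromaticStep χ (steinerWalk st) (λ eq → contradiction (≡.trans (≡.sym χ-r) (≡.trans eq χ-v)) λ ())
        ...   | y , z , e , χy≢χz with pathSubgraph-edge⁻ pathᴳ (edge-⊑ y z e)
        ...     | inj₁ yz with χ-edge yz
        ...       | inj₁ χy≡χz = contradiction χy≡χz χy≢χz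
        ...       | inj₂ (≡.refl , ≡.refl) = e
        consecutive-S′ c | χ , χ-r , χ-v , χ-edge | y , z , e , χy≢χz | inj₂ zy with χ-edge zy
        ...       | inj₁ χz≡χy = contradiction (≡.sym χz≡χy) χy≢χz
        ...       | inj₂ (≡.refl , ≡.refl) = edge-flip S′ e
        edge-S′ : ∀ {a b} → Consecutive a b L ⊎ Consecutive b a L → T (edge S′ a b)
        edge-S′ (inj₁ c) = consecutive-S′ c
        edge-S′ (inj₂ c) = edge-flip S′ (consecutive-S′ c)
        vtx-S′ : ∀ w → ∃[ z ] (Consecutive w z L ⊎ Consecutive z w L) → T (vtx S′ w)
        vtx-S′ w (z , inj₁ c) = edge⇒vtx S′ w z (consecutive-S′ c)
        vtx-S′ w (z , inj₂ c) = edge⇒vtx S′ w z (edge-flip S′ (consecutive-S′ c))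

  module _ (S : Subgraph G) where

    row : Fin order → Fin order → Carrier
    row i j = if (toℕ i <ᵇ toℕ j) ∧ edge S (from i) (from j) then len (from i) (from j) else 0#

    row-edge : ∀ i j → T ((toℕ i <ᵇ toℕ j) ∧ edge S (from i) (from j)) → T (edge S (from i) (from j))
    row-edge i j = proj₂ ∘ Equivalence.to (T-∧ {toℕ i <ᵇ toℕ j})

    row-nonneg : ∀ i j → 0# ≤ row i j
    row-nonneg i j = entry-nonneg ((toℕ i <ᵇ toℕ j) ∧ edge S (from i) (from j))
      (λ t → 0≤len (edge⇒adj S _ _ (row-edge i j t)))

    -- `cost` counts an undirected edge at the pair with increasing indices, so an edge must be
    -- turned into that orientation before it can be found in the sum.
    ordered-edge : ∀ {u v} → T (edge S u v) →
                   ∃[ i ] ∃[ j ] toℕ i ℕ.< toℕ j × T (edge S (from i) (from j)) ×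
                     len (from i) (from j) ≈ len u v × (from i ≡ u × from j ≡ v ⊎ from i ≡ v × from j ≡ u)
    ordered-edge {u} {v} e with ℕ.<-cmp (toℕ (to u)) (toℕ (to v))
    ... | tri< lt _ _ = to u , to v , lt , subst₂ (λ x y → T (edge S x y)) (≡.sym fu) (≡.sym fv) e
                      , reflexive (cong₂ len fu fv) , inj₁ (fu , fv)
      where fu = strictlyInverseʳ u; fv = strictlyInverseʳ v
    ... | tri≈ _ eq _ = contradiction
        (≡.trans (≡.sym (strictlyInverseʳ u)) (≡.trans (cong from (Fin.toℕ-injective eq)) (strictlyInverseʳ v)))
        (adj⇒≢ (edge⇒adj S u v e))
    ... | tri> _ _ gt = to v , to u , gt , subst₂ (λ x y → T (edge S x y)) (≡.sym fv) (≡.sym fu) (edge-flip S e)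
                      , trans (reflexive (cong₂ len fv fu)) (len-sym v u (adj-flip (edge⇒adj S u v e)))
                      , inj₂ (fv , fu)
      where fu = strictlyInverseʳ u; fv = strictlyInverseʳ v

    row-≥ : ∀ {i j w} → toℕ i ℕ.< toℕ j → T (edge S (from i) (from j)) →
            w ≤ len (from i) (from j) → w ≤ row i j
    row-≥ {i} {j} i<j e w≤ = entry-≥ ((toℕ i <ᵇ toℕ j) ∧ edge S (from i) (from j))
      (Equivalence.from T-∧ (ℕ.<⇒<ᵇ i<j , e)) w≤

    -- The edges form a matching, so their endpoints of smaller index are distinct. Each edge then
    -- lies in a row of its own in the double sum, and one term per row suffices.
    cost-≥ : ∀ {B} w (f g : Fin B → V) → 0# ≤ w → (∀ b → T (edge S (f b) (g b))) →
             (∀ b → w ≤ len (f b) (g b)) →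
             (∀ b b′ → f b ≡ f b′ ⊎ f b ≡ g b′ ⊎ g b ≡ f b′ ⊎ g b ≡ g b′ → b ≡ b′) →
             fromℕ B * w ≤ cost G S
    cost-≥ {B} w f g 0≤w e w≤ disjoint =
      sum-≥-multiple w (λ i → sum (row i)) lo (λ i → sum-nonneg (row i) (row-nonneg i)) lo-inj lo-≥
      where
      open Sums +-commutativeMonoid using (sum)
      oriented = λ b → ordered-edge (e b)
      lo : Fin B → Fin order
      lo b = proj₁ (oriented b)
      lo-inj : ∀ {b b′} → lo b ≡ lo b′ → b ≡ b′
      lo-inj {b} {b′} eq with oriented b | oriented b′
      ... | _ , _ , _ , _ , _ , inj₁ (p , _) | _ , _ , _ , _ , _ , inj₁ (q , _) =
        disjoint b b′ (inj₁ (≡.trans (≡.sym p) (≡.trans (cong from eq) q)))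
      ... | _ , _ , _ , _ , _ , inj₁ (p , _) | _ , _ , _ , _ , _ , inj₂ (q , _) =
        disjoint b b′ (inj₂ (inj₁ (≡.trans (≡.sym p) (≡.trans (cong from eq) q))))
      ... | _ , _ , _ , _ , _ , inj₂ (p , _) | _ , _ , _ , _ , _ , inj₁ (q , _) =
        disjoint b b′ (inj₂ (inj₂ (inj₁ (≡.trans (≡.sym p) (≡.trans (cong from eq) q)))))
      ... | _ , _ , _ , _ , _ , inj₂ (p , _) | _ , _ , _ , _ , _ , inj₂ (q , _) =
        disjoint b b′ (inj₂ (inj₂ (inj₂ (≡.trans (≡.sym p) (≡.trans (cong from eq) q)))))
      lo-≥ : ∀ b → w ≤ sum (row (lo b))
      lo-≥ b with oriented b
      ... | i , j , i<j , eᵢⱼ , len≈ , _ = begin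
        w                ≈⟨ *-identityˡ w ⟨
        1# * w           ≈⟨ *-congʳ (+-identityʳ 1#) ⟨
        fromℕ 1 * w      ≤⟨ sum-≥-multiple {1} w (row i) (λ _ → j) (row-nonneg i) (λ { {fzero} {fzero} _ → ≡.refl })
                              (λ _ → row-≥ i<j eᵢⱼ (≤-trans (w≤ b) (≤-reflexive (sym len≈)))) ⟩
        sum (row i)      ∎
        where open ≤-Reasoning

    cost-≥-edge : ∀ {u v} → T (edge S u v) → len u v ≤ cost G S
    cost-≥-edge {u} {v} e = begin
      len u v           ≈⟨ *-identityˡ _ ⟨
      1# * len u v      ≈⟨ *-congʳ (+-identityʳ 1#) ⟨
      fromℕ 1 * len u v ≤⟨ cost-≥ {1} (len u v) (λ _ → u) (λ _ → v) (0≤len (edge⇒adj S u v e)) (λ _ → e)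
                             (λ _ → ≤-refl) (λ { fzero fzero _ → ≡.refl }) ⟩
      cost G S          ∎
      where open ≤-Reasoning

    cost-single : ∀ {u v} → T (edge S u v) →
                  (∀ {a b} → T (edge S a b) → a ≡ u × b ≡ v ⊎ a ≡ v × b ≡ u) → cost G S ≈ len u v
    cost-single {u} {v} e single with ordered-edge e
    ... | i₀ , j₀ , i₀<j₀ , e₀ , len≈ , which = trans
      (sum-single (λ i → sum (row i)) i₀ λ i i≢i₀ → sum-zero (row i) λ j → row-zero λ (i≡i₀ , _) → i≢i₀ i≡i₀)
      (trans (sum-single (row i₀) j₀ λ j j≢j₀ → row-zero λ (_ , j≡j₀) → j≢j₀ j≡j₀)
        (trans (≤-antisym row-≤ (row-≥ i₀<j₀ e₀ ≤-refl)) len≈))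
      where
      open Sums +-commutativeMonoid using (sum)
      row-≤ : row i₀ j₀ ≤ len (from i₀) (from j₀)
      row-≤ with (toℕ i₀ <ᵇ toℕ j₀) ∧ edge S (from i₀) (from j₀)
      ... | true  = ≤-refl
      ... | false = 0≤len (edge⇒adj S _ _ e₀)
      from⁻¹ : ∀ {i j} → from i ≡ from j → i ≡ j
      from⁻¹ eq = ≡.trans (≡.sym (strictlyInverseˡ _)) (≡.trans (cong to eq) (strictlyInverseˡ _))
      align : ∀ {i j} → toℕ i ℕ.< toℕ j → from i ≡ u × from j ≡ v ⊎ from i ≡ v × from j ≡ u →
              from i₀ ≡ u × from j₀ ≡ v ⊎ from i₀ ≡ v × from j₀ ≡ u → i ≡ i₀ × j ≡ j₀
      align i<j (inj₁ (p , q)) (inj₁ (p₀ , q₀)) = from⁻¹ (≡.trans p (≡.sym p₀)) , from⁻¹ (≡.trans q (≡.sym q₀))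
      align i<j (inj₂ (p , q)) (inj₂ (p₀ , q₀)) = from⁻¹ (≡.trans p (≡.sym p₀)) , from⁻¹ (≡.trans q (≡.sym q₀))
      align i<j (inj₁ (p , q)) (inj₂ (p₀ , q₀)) = contradiction i<j (ℕ.<-asym (subst₂ (λ x y → toℕ x ℕ.< toℕ y)
        (from⁻¹ (≡.trans p₀ (≡.sym q))) (from⁻¹ (≡.trans q₀ (≡.sym p))) i₀<j₀))
      align i<j (inj₂ (p , q)) (inj₁ (p₀ , q₀)) = contradiction i<j (ℕ.<-asym (subst₂ (λ x y → toℕ x ℕ.< toℕ y)
        (from⁻¹ (≡.trans p₀ (≡.sym q))) (from⁻¹ (≡.trans q₀ (≡.sym p))) i₀<j₀))
      row-zero : ∀ {i j} → ¬ (i ≡ i₀ × j ≡ j₀) → row i j ≈ 0#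
      row-zero {i} {j} ≢ = entry-zero ((toℕ i <ᵇ toℕ j) ∧ edge S (from i) (from j)) λ t →
        ≢ (align (ℕ.<ᵇ⇒< _ _ (proj₁ (Equivalence.to T-∧ t))) (single (row-edge i j t)) which)

  module _ (r : V) where

    -- A tree that contains the root and another vertex has an edge at the root, and all of these
    -- have length `W`; the single edge to `v` attains this.
    neighbour-opt : ∀ {v W} → T (adj r v) → (∀ x → T (adj r x) → len r x ≈ W) → IsOpt G r (only r v) W
    neighbour-opt {v} {W} rv len≈W =
      ( S
      , steinerTree-only r tree (pathSubgraph-vtx⁺ path (here ≡.refl)) (pathSubgraph-vtx⁺ path (there (here ≡.refl)))
      , trans (cost-single S (pathSubgraph-edge⁺ path here) single) (len≈W v rv) )
      , lower
      where
      path : Path (λ x y → T (adj x y)) r v (v ∷ [])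
      path = rv ∷ []
      S = pathSubgraph path
      consecutive-pair : ∀ {a b} → Consecutive a b (r ∷ v ∷ []) → a ≡ r × b ≡ v
      consecutive-pair here = ≡.refl , ≡.refl
      consecutive-pair (there (there ()))
      single : ∀ {a b} → T (edge S a b) → a ≡ r × b ≡ v ⊎ a ≡ v × b ≡ r
      single e with pathSubgraph-edge⁻ path e
      ... | inj₁ c = inj₁ (consecutive-pair c)
      ... | inj₂ c with p , q ← consecutive-pair c = inj₂ (q , p)
      no-cycle : ∀ w ws → ¬ IsCycle G S w ws
      no-cycle w [] (_ , () , _)
      no-cycle w (_ ∷ []) (_ , s≤s () , _)
      no-cycle w (x ∷ y ∷ ws) ((w≢x ∷ w≢y ∷ _) ∷ _ , _ , wx ∷ xy ∷ _) with single wx | single xy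
      ... | inj₁ (≡.refl , ≡.refl) | inj₁ (≡.refl , _) = w≢x ≡.refl
      ... | inj₁ (≡.refl , ≡.refl) | inj₂ (_ , ≡.refl) = w≢y ≡.refl
      ... | inj₂ (≡.refl , ≡.refl) | inj₁ (_ , ≡.refl) = w≢y ≡.refl
      ... | inj₂ (≡.refl , ≡.refl) | inj₂ (≡.refl , _) = w≢x ≡.refl
      tree = pathSubgraph-isTree path no-cycle
      lower : ∀ S′ → SteinerTree G r (only r v) S′ → W ≤ cost G S′
      lower S′ st with steinerWalk r st
      ... | ε = contradiction ≡.refl (adj⇒≢ rv)
      ... | e ◅ _ = ≤-trans (≤-reflexive (sym (len≈W _ (edge⇒adj S′ _ _ e)))) (cost-≥-edge S′ e)

-- The block graph: distances, sparsity and the tree path.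

module BlockGraph {c ℓ₁ ℓ₂} (F : ArchimedeanOrderedField c ℓ₁ ℓ₂) (k′ m : ℕ)
  (L : ℕ → ArchimedeanOrderedField.Carrier F)
  (1≤L : ∀ s → ArchimedeanOrderedField._≤_ F (ArchimedeanOrderedField.1# F) (L s))
  (L-1 : ArchimedeanOrderedField._≈_ F (L 1) (ArchimedeanOrderedField.1# F))
  where

  open ArchimedeanOrderedField F
  open OrderedFieldProperties F
  open Blocks k′
  open Steiner F

  0≤L : ∀ s → 0# ≤ L s
  0≤L s = ≤-trans 0≤1 (1≤L s)

  module _ {A : Set} (E : A → A → Set) (s : A → A → ℕ) (t : ℕ) where

    -- A walk of length at most ρ whose edges all have separation at most t, so that it stays in one
    -- cluster of level t. The vertex type is arbitrary, which lets walks be carried from a block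
    -- into the item and the cell around it.
    data Reach : A → A → Carrier → Set (c ⊔ ℓ₁ ⊔ ℓ₂) where
      here : ∀ {u ρ} → 0# ≤ ρ → Reach u u ρ
      step : ∀ {u v w ρ σ} → E u v → s u v ℕ.≤ t → Reach v w σ → L (s u v) + σ ≤ ρ → Reach u w ρ

  module _ {A : Set} {E : A → A → Set} {s : A → A → ℕ} {t : ℕ} where

    reach-weaken : ∀ {u v ρ σ} → Reach E s t u v ρ → ρ ≤ σ → Reach E s t u v σ
    reach-weaken (here 0≤ρ)      ρ≤σ = here (≤-trans 0≤ρ ρ≤σ)
    reach-weaken (step e p r ≤ρ) ρ≤σ = step e p r (≤-trans ≤ρ ρ≤σ)

    reach-edge : ∀ {u v} → E u v → s u v ℕ.≤ t → Reach E s t u v (L (s u v))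
    reach-edge e p = step e p (here ≤-refl) (≤-reflexive (+-identityʳ _))

    reach-trans : ∀ {u v w ρ σ} → Reach E s t u v ρ → Reach E s t v w σ → Reach E s t u w (ρ + σ)
    reach-trans (here 0≤ρ) r = reach-weaken r (x≤y+x 0≤ρ)
    reach-trans {σ = σ} (step {ρ = ρ} {σ′} e p r ≤ρ) r′ = step e p (reach-trans r r′)
      (≤-trans (≤-reflexive (sym (+-assoc _ _ _))) (+-monoˡ-≤ σ ≤ρ))

    reach-sym : (∀ {u v} → E u v → E v u) → (∀ u v → s u v ≡ s v u) →
                ∀ {u v ρ} → Reach E s t u v ρ → Reach E s t v u ρ
    reach-sym E-sym s-sym (here 0≤ρ) = here 0≤ρ
    reach-sym E-sym s-sym (step {u} {v} {ρ = ρ} {σ} e p r ≤ρ) = reach-weaken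
      (reach-trans (reach-sym E-sym s-sym r) (reach-edge (E-sym e) (subst (ℕ._≤ t) (s-sym u v) p)))
      (begin
        σ + L (s v u) ≈⟨ +-comm _ _ ⟩
        L (s v u) + σ ≡⟨ cong (λ n → L n + σ) (s-sym v u) ⟩
        L (s u v) + σ ≤⟨ ≤ρ ⟩
        ρ             ∎)
      where open ≤-Reasoning

    reach-map : ∀ {B : Set} {E′ : B → B → Set} {s′ : B → B → ℕ} {t′} (f : A → B) →
                (∀ {u v} → E u v → E′ (f u) (f v)) → (∀ u v → s′ (f u) (f v) ≡ s u v) → t ℕ.≤ t′ →
                ∀ {u v ρ} → Reach E s t u v ρ → Reach E′ s′ t′ (f u) (f v) ρ
    reach-map f fE fs t≤t′ (here 0≤ρ) = here 0≤ρ
    reach-map f fE fs t≤t′ (step {u} {v} {ρ = ρ} {σ} e p r ≤ρ) = step (fE e)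
      (subst (ℕ._≤ _) (≡.sym (fs u v)) (ℕ.≤-trans p t≤t′)) (reach-map f fE fs t≤t′ r)
      (subst (λ n → L n + σ ≤ ρ) (≡.sym (fs u v)) ≤ρ)

  infix 4 _—_ _—ᶜ_
  _—_ : ∀ {j} → Block j → Block j → Set
  u — v = u ↝ v ⊎ v ↝ u
  _—ᶜ_ : ∀ {j} → Cell j → Cell j → Set
  x —ᶜ y = x ↝ᶜ y ⊎ y ↝ᶜ x

  Reachᴮ : ∀ {j} → ℕ → Block j → Block j → Carrier → Set (c ⊔ ℓ₁ ⊔ ℓ₂)
  Reachᴮ = Reach _—_ sep
  Reachᶜ : ∀ {j} → ℕ → Cell j → Cell j → Carrier → Set (c ⊔ ℓ₁ ⊔ ℓ₂)
  Reachᶜ = Reach _—ᶜ_ sepᶜ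

  item-reach : ∀ {j t t′} a {x y : Cell j} {ρ} → t ℕ.≤ t′ → Reachᶜ t x y ρ → Reachᴮ t′ (a ▸ x) (a ▸ y) ρ
  item-reach a t≤t′ r = reach-map (a ▸_) (Sum.map item item) (sep-▸ a) t≤t′ r

  inside-reach : ∀ {j t t′} {u v : Block j} {ρ} → t ℕ.≤ t′ → Reachᴮ t u v ρ → Reachᶜ t′ (just u) (just v) ρ
  inside-reach t≤t′ r = reach-map just (Sum.map inside inside) (λ _ _ → ≡.refl) t≤t′ r

  hub-reach : ∀ {j} (v : Block j) → nothing —ᶜ just v → Reachᶜ (suc (suc j)) nothing (just v) (L (suc (suc j)))
  hub-reach v e = reach-edge e ℕ.≤-refl

  reachᶜ-sym : ∀ {j t ρ} {x y : Cell j} → Reachᶜ t x y ρ → Reachᶜ t y x ρ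
  reachᶜ-sym r = reach-sym swap sepᶜ-sym r

  reachᴮ-sym : ∀ {j t ρ} {x y : Block j} → Reachᴮ t x y ρ → Reachᴮ t y x ρ
  reachᴮ-sym r = reach-sym swap sep-sym r

  -- Going back by one item takes three edges of the same length: the link, then from exit to hub
  -- and from hub to entrance.
  chain-reach : ∀ {j} n (a : Fin k) → toℕ a ≡ n →
    let ℓ = L (suc (suc j)) in
    Reachᴮ (suc (suc j)) (a ▸ just (inn j)) (fzero ▸ just (inn j)) (fromℕ n * (ℓ + (ℓ + ℓ)))
  chain-reach zero fzero _ = here (≤-reflexive (sym (zeroˡ _)))
  chain-reach {j} (suc n) (fsuc b) eq = reach-weaken
    (reach-trans (reach-trans (reach-weaken back (≤-reflexive (reflexive (cong L apart))))
      (item-reach b′ ℕ.≤-refl (reach-trans (reachᶜ-sym (hub-reach _ (inj₁ exit))) (hub-reach _ (inj₁ entry)))))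
      (chain-reach n b′ (≡.trans (Fin.toℕ-inject₁ b) (ℕ.suc-injective eq))))
    (≤-reflexive (trans (+-congʳ (sym (*-identityˡ _))) (sym (distribʳ (ℓ + (ℓ + ℓ)) 1# (fromℕ n)))))
    where
    ℓ = L (suc (suc j))
    b′ = Fin.inject₁ b
    apart : sep (fsuc b ▸ just (inn j)) (b′ ▸ just (out j)) ≡ suc (suc j)
    apart = sep-▸-≢ {x = just (inn j)} {just (out j)} (λ e → ℕ.1+n≢n (≡.trans (cong toℕ e) (Fin.toℕ-inject₁ b)))
    back : Reachᴮ (suc (suc j)) (fsuc b ▸ just (inn j)) (b′ ▸ just (out j)) _
    back = reach-edge (inj₂ (link (cong suc (≡.sym (Fin.toℕ-inject₁ b))))) (ℕ.≤-reflexive apart)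

  -- A bound for the distance to the first entrance in a block of level j + 1
  -- when the blocks of level j have diameter at most δ.
  startDistance : Carrier → ℕ → Carrier
  startDistance δ j = δ + (ℓ + fromℕ k′ * (ℓ + (ℓ + ℓ)))
    where ℓ = L (suc (suc j))

  module Diameters (Δ : ℕ → Carrier) (0≤Δ : ∀ j → 0# ≤ Δ j) (L-1≤Δ-0 : L 1 ≤ Δ 0)
    (Δ-step : ∀ j → j ℕ.< m → startDistance (Δ j) j + startDistance (Δ j) j ≤ Δ (suc j))
    where

    block-reach : ∀ j → j ℕ.≤ m → (u v : Block j) → Reachᴮ (suc j) u v (Δ j)
    block-reach zero    _ (end false) (end false) = here (0≤Δ 0)
    block-reach zero    _ (end true)  (end true)  = here (0≤Δ 0)
    block-reach zero    _ (end false) (end true)  = reach-weaken (reach-edge (inj₁ pair) ℕ.≤-refl) L-1≤Δ-0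
    block-reach zero    _ (end true)  (end false) = reach-weaken (reach-edge (inj₂ pair) ℕ.≤-refl) L-1≤Δ-0
    block-reach (suc j) j<m u v = reach-weaken (reach-trans (to-start u) (reachᴮ-sym (to-start v))) (Δ-step j j<m)
      where
      ℓ = L (suc (suc j))
      to-inn : (x : Cell j) → Reachᶜ (suc (suc j)) x (just (inn j)) (Δ j + ℓ)
      to-inn nothing  = reach-weaken (hub-reach _ (inj₁ entry)) (x≤y+x (0≤Δ j))
      to-inn (just w) = reach-weaken (inside-reach (ℕ.n≤1+n _) (block-reach j (ℕ.<⇒≤ j<m) w (inn j))) (x≤x+y (0≤L _))
      to-start : (w : Block (suc j)) → Reachᴮ (suc (suc j)) w (inn (suc j)) (startDistance (Δ j) j)
      to-start (a ▸ x) = reach-weaken (reach-trans (item-reach a ℕ.≤-refl (to-inn x)) (chain-reach (toℕ a) a ≡.refl))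
        (begin
          Δ j + ℓ + fromℕ (toℕ a) * (ℓ + (ℓ + ℓ))   ≈⟨ +-assoc _ _ _ ⟩
          Δ j + (ℓ + fromℕ (toℕ a) * (ℓ + (ℓ + ℓ))) ≤⟨ +-monoʳ-≤ _ (+-monoʳ-≤ _ (*-monoˡ-≤ 0≤3ℓ (fromℕ-mono-≤ (Fin.toℕ≤pred[n] a)))) ⟩
          Δ j + (ℓ + fromℕ k′ * (ℓ + (ℓ + ℓ)))      ∎)
        where
        open ≤-Reasoning
        0≤3ℓ : 0# ≤ ℓ + (ℓ + ℓ)
        0≤3ℓ = 0≤+ (0≤L _) (0≤+ (0≤L _) (0≤L _))

    -- A cluster of level t + 1 with more than one vertex is a block of level t, however deep it
    -- lies; the recursion descends to that block. A hub above it has separation larger than t + 1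
    -- from its block, which excludes the mixed cases.
    cluster-reach : ∀ {j t} → j ℕ.≤ m → t ℕ.≤ j → (u v : Block j) → sep u v ℕ.≤ suc t → Reachᴮ (suc t) u v (Δ t)
    cluster-reachᶜ : ∀ {j t} → j ℕ.≤ m → t ℕ.≤ j → (x y : Cell j) → sepᶜ x y ℕ.≤ suc t → Reachᶜ (suc t) x y (Δ t)
    cluster-reach {j} {t} j≤m t≤j u v p with ℕ.m≤n⇒m<n∨m≡n t≤j
    ... | inj₂ ≡.refl = block-reach j j≤m u v
    cluster-reach {suc j} j<m t≤j (a ▸ x) (b ▸ y) p | inj₁ (s≤s t≤j′) with a Fin.≟ b
    ... | yes ≡.refl = item-reach a ℕ.≤-refl (cluster-reachᶜ (ℕ.<⇒≤ j<m) t≤j′ x y p)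
    ... | no  _      = contradiction (ℕ.≤-trans p (s≤s t≤j′)) ℕ.1+n≰n
    cluster-reachᶜ {t = t} j≤m t≤j nothing nothing p = here (0≤Δ t)
    cluster-reachᶜ j≤m t≤j (just u) (just v) p = inside-reach ℕ.≤-refl (cluster-reach j≤m t≤j u v p)
    cluster-reachᶜ j≤m t≤j nothing  (just v) p = contradiction (ℕ.≤-trans p (s≤s t≤j)) ℕ.1+n≰n
    cluster-reachᶜ j≤m t≤j (just u) nothing  p = contradiction (ℕ.≤-trans p (s≤s t≤j)) ℕ.1+n≰n

    top-reach : (x y : Cell m) → Reachᶜ (suc (suc m)) x y (L (suc (suc m)) + Δ m)
    top-reach nothing  nothing  = here (0≤+ (0≤L _) (0≤Δ m))
    top-reach nothing  (just v) = reach-trans (hub-reach _ (inj₁ entry))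
      (inside-reach (ℕ.n≤1+n _) (block-reach m ℕ.≤-refl (inn m) v))
    top-reach (just u) nothing  = reachᶜ-sym (top-reach nothing (just u))
    top-reach (just u) (just v) = reach-weaken (inside-reach (ℕ.n≤1+n _) (block-reach m ℕ.≤-refl u v)) (x≤y+x (0≤L _))

  Vertex : Set
  Vertex = Cell m

  root : Vertex
  root = nothing

  adjacent : Vertex → Vertex → Bool
  adjacent x y = ⌊ x ↝ᶜ? y ⌋ ∨ ⌊ y ↝ᶜ? x ⌋

  adjacent⁻ : ∀ {x y} → T (adjacent x y) → x —ᶜ y
  adjacent⁻ {x} {y} t = Sum.map toWitness toWitness (Equivalence.to (T-∨ {⌊ x ↝ᶜ? y ⌋}) t)

  adjacent⁺ : ∀ {x y} → x —ᶜ y → T (adjacent x y)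
  adjacent⁺ {x} {y} e = Equivalence.from (T-∨ {⌊ x ↝ᶜ? y ⌋}) (Sum.map fromWitness fromWitness e)

  adjacent-irrefl : ∀ x → adjacent x x ≡ false
  adjacent-irrefl x with adjacent x x in eq
  ... | false = ≡.refl
  ... | true with adjacent⁻ {x} {x} (subst T (≡.sym eq) tt)
  ...   | inj₁ e = contradiction ≡.refl (↝ᶜ-irrefl e)
  ...   | inj₂ e = contradiction ≡.refl (↝ᶜ-irrefl e)

  firstLeaf : ∀ j → Fin (k ℕ.^ j)
  firstLeaf zero    = fzero
  firstLeaf (suc j) = Fin.combine {k} fzero (firstLeaf j)

  leaf-edge : ∀ j i → leaf j i false ↝ leaf j i true
  leaf-edge zero    i = pair
  leaf-edge (suc j) i = item (inside (leaf-edge j _))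

  leaf-sep : ∀ j i → sep (leaf j i false) (leaf j i true) ≡ 1
  leaf-sep zero    i = ≡.refl
  leaf-sep (suc j) i = ≡.trans (sep-▸ a (just (leaf j i′ false)) (just (leaf j i′ true))) (leaf-sep j i′)
    where
    a  = proj₁ (remQuot {k} (k ℕ.^ j) i)
    i′ = proj₂ (remQuot {k} (k ℕ.^ j) i)

  reach-star : ∀ {t ρ} {x y : Vertex} → Reachᶜ t x y ρ → Star (λ u v → T (adjacent u v)) x y
  reach-star (here _)       = ε
  reach-star (step e _ r _) = adjacent⁺ e ◅ reach-star r

  -- Connectivity is a parameter since it will be read off from the diameter bounds, which depend on
  -- the choice of the lengths.
  module WithConnectivity (connected : (x y : Vertex) → Star (λ u v → T (adjacent u v)) x y) where

    G : Graph
    G = record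
      { V          = Vertex
      ; order      = suc (size m)
      ; enum       = Maybe↔ (enumerate m)
      ; adj        = adjacent
      ; adj-sym    = λ x y → ∨-comm ⌊ x ↝ᶜ? y ⌋ ⌊ y ↝ᶜ? x ⌋
      ; adj-irrefl = adjacent-irrefl
      ; len        = λ x y → L (sepᶜ x y)
      ; len-sym    = λ x y _ → reflexive (cong L (sepᶜ-sym x y))
      ; 1≤len      = λ x y _ → 1≤L (sepᶜ x y)
      ; len≈1      = just (leaf m (firstLeaf m) false) , just (leaf m (firstLeaf m) true)
                   , adjacent⁺ (inj₁ (inside (leaf-edge m _)))
                   , trans (reflexive (cong L (leaf-sep m _))) L-1
      ; connected  = connected
      }

    open GraphProperties F G

    -- A cluster is closed under edges of small separation, so a `Reach` starting in it is a walk of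
    -- the induced subgraph; this yields strong diameter.
    reach-dist : ∀ {t ρ} {C : Vertex → Set} → (∀ {u v} → C u → sepᶜ u v ℕ.≤ t → C v) →
                 ∀ {x y} → C x → Reachᶜ t x y ρ → Dist≤ G C x y ρ
    reach-dist closed x∈C (here 0≤ρ) = ε , 0≤ρ
    reach-dist closed x∈C (step e q r ≤ρ) with reach-dist closed (closed x∈C q) r
    ... | w , w≤ = (adjacent⁺ e , x∈C , closed x∈C q) ◅ w , ≤-trans (+-monoʳ-≤ _ w≤) ≤ρ

    Walk : Vertex → Vertex → Set
    Walk = Star (Induced G (Everywhere G))

    root-edge-sep : ∀ y → T (adjacent root y) → sepᶜ root y ≡ suc (suc m)
    root-edge-sep (just _) _ = ≡.refl

    root-walk : ∀ {y} → y ≢ root → (w : Walk root y) → L (suc (suc m)) ≤ walkLength G w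
    root-walk y≢r ε = contradiction ≡.refl y≢r
    root-walk y≢r (_◅_ {j = z} (e , _) w) = ≤-trans (≤-reflexive (reflexive (cong L (≡.sym (root-edge-sep z e)))))
      (x≤x+y (walkLength-nonneg proj₁ w))

    module _ {t R} (far : ∀ s → suc t ℕ.< s → R < L s) where

      -- An edge of separation below t + 1 leaves the cluster of level t and its number unchanged,
      -- one of separation t + 1 costs `L (suc t)` and moves the number by at most 2, and a single
      -- edge of larger separation already exceeds R.
      walk-crossings : ∀ {x y} (w : Walk x y) → R < walkLength G w ⊎
        (∃[ h ] fromℕ h * L (suc t) ≤ walkLength G w × ∣ codeᶜ t x - codeᶜ t y ∣ ℕ.≤ 2 ℕ.* h × sepᶜ x y ℕ.≤ suc t)
      walk-crossings {x} ε = inj₂ (0 , ≤-reflexive (zeroˡ _) , ℕ.≤-reflexive (ℕ.∣n-n∣≡0 (codeᶜ t x))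
                                   , subst (ℕ._≤ suc t) (≡.sym (sepᶜ-refl x)) z≤n)
      walk-crossings {x} {z} (_◅_ {j = y} (e , _) w) with walk-crossings w
      ... | inj₁ R<w = inj₁ (<-≤-trans R<w (x≤y+x (0≤L _)))
      ... | inj₂ (h , hL≤ , code≤ , sep≤) with ℕ.<-cmp (sepᶜ x y) (suc t)
      ...   | tri< (s≤s s≤t) _ _ = inj₂ (h , ≤-trans hL≤ (x≤y+x (0≤L _))
                , subst (λ n → ∣ n - codeᶜ t z ∣ ℕ.≤ 2 ℕ.* h) (≡.sym (codeᶜ-cong x y s≤t)) code≤
                , sepᶜ-ultrametric x y z (ℕ.m≤n⇒m≤1+n s≤t) sep≤)
      ...   | tri> _ _ t<s = inj₁ (<-≤-trans (far _ t<s) (x≤x+y (walkLength-nonneg proj₁ w)))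
      ...   | tri≈ _ s≡ _ = inj₂ (suc h , (begin
                (1# + fromℕ h) * L (suc t)            ≈⟨ distribʳ _ _ _ ⟩
                1# * L (suc t) + fromℕ h * L (suc t)  ≈⟨ +-congʳ (*-identityˡ _) ⟩
                L (suc t) + fromℕ h * L (suc t)       ≤⟨ +-monoʳ-≤ _ hL≤ ⟩
                L (suc t) + walkLength G w            ≡⟨ cong (λ n → L n + walkLength G w) s≡ ⟨
                L (sepᶜ x y) + walkLength G w         ∎)
              , codes , sepᶜ-ultrametric x y z (ℕ.≤-reflexive s≡) sep≤)
        where
        open ≤-Reasoning
        crossing : ∣ codeᶜ t x - codeᶜ t y ∣ ℕ.≤ 2
        crossing with adjacent⁻ {x} {y} e
        ... | inj₁ e₁ = codeᶜ-edge {x = x} {y} e₁ s≡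
        ... | inj₂ e₂ = subst (ℕ._≤ 2) (ℕ.∣-∣-comm (codeᶜ t y) (codeᶜ t x)) (codeᶜ-edge {x = y} {x} e₂ (≡.trans (sepᶜ-sym y x) s≡))
        codes : ∣ codeᶜ t x - codeᶜ t z ∣ ℕ.≤ 2 ℕ.* suc h
        codes = ℕ.≤-trans (ℕ.∣-∣-triangle (codeᶜ t x) (codeᶜ t y) (codeᶜ t z))
          (ℕ.≤-trans (ℕ.+-mono-≤ crossing code≤) (ℕ.≤-reflexive (≡.sym (ℕ.*-suc 2 h))))

      module _ {h} (R<[1+h]L : R < fromℕ (suc h) * L (suc t)) where

        ball-code : ∀ {x y} → Ball G x R y → ∣ codeᶜ t x - codeᶜ t y ∣ ℕ.≤ 2 ℕ.* h × sepᶜ x y ℕ.≤ suc t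
        ball-code (w , w≤R) with walk-crossings w
        ... | inj₁ R<w = contradiction w≤R (<⇒≱ R<w)
        ... | inj₂ (n , nL≤ , code≤ , sep≤) = ℕ.≤-trans code≤ (ℕ.*-monoʳ-≤ 2 n≤h) , sep≤
          where
          n≤h : n ℕ.≤ h
          n≤h with n ℕ.≤? h
          ... | yes n≤h = n≤h
          ... | no n≰h = contradiction (≤-trans (*-monoˡ-≤ (0≤L _) (fromℕ-mono-≤ (ℕ.≰⇒> n≰h))) (≤-trans nL≤ w≤R)) (<⇒≱ R<[1+h]L)

        ball-sparse : ∀ v n (x : Fin n → Vertex) → (∀ i → Ball G v R (x i)) →
                      (∀ i j → i ≢ j → ¬ (sepᶜ (x i) (x j) ℕ.≤ t)) → n ℕ.≤ suc (4 ℕ.* h)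
        ball-sparse v n x in-ball apart = Fin.injective⇒≤ {f = position} position-injective
          where
          cv = codeᶜ t v
          cx : Fin n → ℕ
          cx i = codeᶜ t (x i)
          cv≤ : ∀ i → cv ℕ.≤ cx i ℕ.+ 2 ℕ.* h
          cv≤ i = ℕ.≤-trans (ℕ.m≤n+∣m-n∣ cv (cx i)) (ℕ.+-monoʳ-≤ (cx i) (proj₁ (ball-code (in-ball i))))
          cx≤ : ∀ i → cx i ℕ.≤ cv ℕ.+ 2 ℕ.* h
          cx≤ i = ℕ.≤-trans (ℕ.m≤n+∣n-m∣ (cx i) cv) (ℕ.+-monoʳ-≤ cv (proj₁ (ball-code (in-ball i))))
          offset : Fin n → ℕ
          -- The numbers in the ball lie within 2 h of that of the centre; this shift moves them to
          -- the interval from 0 to 4 h, hence the bound 4 h + 1.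
          offset i = cx i ℕ.+ 2 ℕ.* h ∸ cv
          offset< : ∀ i → offset i ℕ.< suc (4 ℕ.* h)
          offset< i = s≤s (begin
            cx i ℕ.+ 2 ℕ.* h ∸ cv                 ≤⟨ ℕ.∸-monoˡ-≤ cv (ℕ.+-monoˡ-≤ (2 ℕ.* h) (cx≤ i)) ⟩
            cv ℕ.+ 2 ℕ.* h ℕ.+ 2 ℕ.* h ∸ cv       ≡⟨ cong (_∸ cv) (ℕ.+-assoc cv (2 ℕ.* h) (2 ℕ.* h)) ⟩
            cv ℕ.+ (2 ℕ.* h ℕ.+ 2 ℕ.* h) ∸ cv     ≡⟨ ℕ.m+n∸m≡n cv _ ⟩
            2 ℕ.* h ℕ.+ 2 ℕ.* h                   ≡⟨ ℕ.*-distribʳ-+ h 2 2 ⟨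
            4 ℕ.* h                               ∎)
            where open ℕ.≤-Reasoning
          position : Fin n → Fin (suc (4 ℕ.* h))
          position i = Fin.fromℕ< (offset< i)
          code≡ : ∀ {i j} → position i ≡ position j → cx i ≡ cx j
          code≡ {i} {j} eq = ℕ.+-cancelʳ-≡ (2 ℕ.* h) _ _
            (ℕ.∸-cancelʳ-≡ (cv≤ i) (cv≤ j)
              (≡.trans (≡.sym (Fin.toℕ-fromℕ< (offset< i))) (≡.trans (cong toℕ eq) (Fin.toℕ-fromℕ< (offset< j)))))
          position-injective : ∀ {i j} → position i ≡ position j → i ≡ j
          position-injective {i} {j} eq with i Fin.≟ j
          ... | yes i≡j = i≡j
          ... | no  i≢j = contradiction (codeᶜ-injective (x i) (x j)
                  (sepᶜ-ultrametric (x i) v (x j)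
                    (subst (ℕ._≤ suc t) (sepᶜ-sym v (x i)) (proj₂ (ball-code (in-ball i))))
                    (proj₂ (ball-code (in-ball j))))
                  (code≡ eq)) (apart i j i≢j)

    clusters : ℕ → Partition G
    clusters t = record
      { _~_ = λ x y → sepᶜ x y ℕ.≤ t
      ; isDecEquivalence = record
        { isEquivalence = record
          { refl  = λ {x} → subst (ℕ._≤ t) (≡.sym (sepᶜ-refl x)) z≤n
          ; sym   = λ {x} {y} → subst (ℕ._≤ t) (sepᶜ-sym x y)
          ; trans = λ {x} {y} {z} → sepᶜ-ultrametric x y z
          }
        ; _≟_ = λ x y → sepᶜ x y ℕ.≤? t
        }
      }

    clusters-isPartition : ∀ {α β R t h} →
      (∀ x y → sepᶜ x y ℕ.≤ t → Reachᶜ t x y (α * R)) →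
      (∀ s → suc t ℕ.< s → R < L s) →
      R < fromℕ (suc h) * L (suc t) → fromℕ (suc (4 ℕ.* h)) ≤ β →
      IsPartition G α β R (clusters t)
    clusters-isPartition {t = t} {h} reach far R< h≤β = record
      { strongDiameter = λ o u v p q → reach-dist (λ {u} {v} → sepᶜ-ultrametric o u v) p
          (reach u v (sepᶜ-ultrametric u o v (subst (ℕ._≤ t) (sepᶜ-sym o u) p) q))
      ; sparse = λ v n x in-ball apart →
          ≤-trans (fromℕ-mono-≤ (ball-sparse far {h} R< v n x in-ball apart)) h≤β
      }

    module _ (τ : Subgraph G) (spanning : IsSpanningTree G τ)
      (obeys : ∀ t → 1 ℕ.≤ t → t ℕ.≤ suc (suc m) → ∀ x y → sepᶜ x y ℕ.≤ t →
               Star (λ u v → T (Subgraph.edge τ u v) × sepᶜ x u ℕ.≤ t × sepᶜ x v ℕ.≤ t) x y)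
      where

      open Subgraph

      -- The smallest cluster containing p and q does not contain z, and strict obedience makes it
      -- connected in τ, so two edges from z would close a cycle.
      at-most-one-edge : AtMostOneEdgeTo (edge τ) sepᶜ
      at-most-one-edge z p q zp zq pq<zp with sepᶜ p q in eq
      ... | zero  = sepᶜ≡0⇒≡ p q eq
      ... | suc t = acyclic⇒unique-neighbour {S = τ} (IsTree.acyclic (proj₁ spanning)) (λ x → sepᶜ p x ℕ.≤ suc t)
        (λ pz≤t → ℕ.<⇒≱ pq<zp (subst (ℕ._≤ suc t) (sepᶜ-sym p z) pz≤t))
        (subst (ℕ._≤ suc t) (≡.sym (sepᶜ-refl p)) z≤n) zp zq
        (obeys (suc t) (s≤s z≤n) (ℕ.≤-trans (ℕ.≤-reflexive (≡.sym eq)) (sepᶜ-bound p q)) p q (ℕ.≤-reflexive eq))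

      -- The set X consists of one neighbour of the root. Opt is then the length of a root edge,
      -- while its subtree contains all k ^ m base pairs, each of length at least 1.
      stretch-≥ : ∀ {s} → IsStretch G root τ s → fromℕ (k ℕ.^ m) ≤ s * L (suc (suc m))
      stretch-≥ {s} (bound , _) = begin
        fromℕ (k ℕ.^ m)           ≈⟨ *-identityʳ _ ⟨
        fromℕ (k ℕ.^ m) * 1#      ≤⟨ cost-≥ S 1# (λ i → just (leaf m i false)) (λ i → just (leaf m i true)) 0≤1
                                       leaf∈S (λ _ → 1≤L _) (λ i i′ → disjoint) ⟩
        cost G S                  ≤⟨ bound (only root target) S (L (suc (suc m))) (singleton-nontrivial root target≢root)
                                       minimal (neighbour-opt root root-target (λ y e → reflexive (cong L (root-edge-sep y e)))) ⟩
        s * L (suc (suc m))       ∎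
        where
        open ≤-Reasoning
        module CutAt i = Cutᶜ (cutᶜ (edge τ) at-most-one-edge i)
        -- The colour of the root depends only on whether τ joins it to the entrance, and not on
        -- `i`; the target is the end that has the other colour in every cut.
        targeted : ∃[ v ] T (adjacent root v) × v ≢ root × (∀ i → CutAt.χ i root ≢ CutAt.χ i v)
        targeted with edge τ root (just (inn m))
        ... | true  = just (out m) , adjacent⁺ (inj₁ exit) , (λ ())
                    , λ i χ≡ → contradiction (≡.trans χ≡ (CutAt.χ-out i)) λ ()
        ... | false = just (inn m) , adjacent⁺ (inj₁ entry) , (λ ())
                    , λ i χ≡ → contradiction (≡.trans χ≡ (CutAt.χ-inn i)) λ ()
        target = proj₁ targeted
        root-target = proj₁ (proj₂ targeted)
        target≢root = proj₁ (proj₂ (proj₂ targeted))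
        subtree = minimalSubtree root τ (proj₁ spanning) (proj₂ spanning root) (proj₂ spanning target) target≢root
        S = proj₁ subtree
        minimal = proj₂ subtree
        open _⊑_ (proj₁ minimal) using (edge-⊑)
        leaf∈S : ∀ i → T (edge S (just (leaf m i false)) (just (leaf m i true)))
        leaf∈S i with bichromaticStep (CutAt.χ i) (steinerWalk root (proj₁ (proj₂ minimal)))
                        (proj₂ (proj₂ (proj₂ targeted)) i)
        ... | x , y , e , χx≢χy with adjacent⁻ (edge⇒adj S x y e)
        ...   | inj₁ p with CutAt.χ-edge i p (edge-⊑ x y e)
        ...     | inj₁ χx≡χy = contradiction χx≡χy χx≢χy
        ...     | inj₂ (≡.refl , ≡.refl) = e
        leaf∈S i | x , y , e , χx≢χy | inj₂ p with CutAt.χ-edge i p (edge-flip τ (edge-⊑ x y e))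
        ...     | inj₁ χy≡χx = contradiction (≡.sym χy≡χx) χx≢χy
        ...     | inj₂ (≡.refl , ≡.refl) = edge-flip S e
        disjoint : ∀ {i i′} → just (leaf m i false) ≡ just (leaf m i′ false) ⊎ just (leaf m i false) ≡ just (leaf m i′ true) ⊎
                   just (leaf m i true) ≡ just (leaf m i′ false) ⊎ just (leaf m i true) ≡ just (leaf m i′ true) → i ≡ i′
        disjoint (inj₁ eq)               = proj₁ (leaf-injective m (just-injective eq))
        disjoint (inj₂ (inj₁ eq))        = proj₁ (leaf-injective m (just-injective eq))
        disjoint (inj₂ (inj₂ (inj₁ eq))) = proj₁ (leaf-injective m (just-injective eq))
        disjoint (inj₂ (inj₂ (inj₂ eq))) = proj₁ (leaf-injective m (just-injective eq))

-- Lengths, hierarchy and estimates for given α, β, γ.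

module _ {c ℓ₁ ℓ₂} (F : ArchimedeanOrderedField c ℓ₁ ℓ₂) where

  open ArchimedeanOrderedField F

  -- The number of items k is the floor of α β γ / 72, and h that of β / 6. The upper bound on k
  -- limits the diameters and the order of the graph; the lower bound, weakened to α β γ / 144,
  -- gives the stretch.
  module LowerBound {α β γ β⁻¹ : Carrier} {k′ h : ℕ}
    (0<α : 0# < α) (1≤β : 1# ≤ β) (α<γ : α < γ) (β<γ : β < γ) (72≤αβ : fromℕ 72 ≤ α * β)
    (β*β⁻¹≈1 : β * β⁻¹ ≈ 1#)
    (72k≤αβγ : fromℕ (suc k′) * fromℕ 72 ≤ α * β * γ)
    (αβγ≤144k : α * β * γ ≤ fromℕ 144 * fromℕ (suc k′))
    (6h≤β : fromℕ h * fromℕ 6 ≤ β) (β<6[1+h] : β < fromℕ (suc h) * fromℕ 6)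
    (m : ℕ)
    where

    open OrderedFieldProperties F
    open Steiner F
    open ≤-Reasoning

    0<β : 0# < β
    0<β = <-≤-trans 0<1 1≤β

    0<γ : 0# < γ
    0<γ = <-trans 0<β β<γ

    1<γ : 1# < γ
    1<γ = ≤-<-trans 1≤β β<γ

    1≤γ : 1# ≤ γ
    1≤γ = inj₁ 1<γ

    αβ≤αγ : α * β ≤ α * γ
    αβ≤αγ = *-monoʳ-≤ (inj₁ 0<α) (inj₁ β<γ)

    1≤αγ : 1# ≤ α * γ
    1≤αγ = ≤-trans (x≤x+y (0≤fromℕ 71)) (≤-trans 72≤αβ αβ≤αγ)

    -- Since α, β < γ, the product α β is below γ², so γ < 4 would contradict α β ≥ 72. It pays for
    -- the factor 4 by which diameters must grow from one level to the next.
    4≤γ : fromℕ 4 ≤ γ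
    4≤γ = ≮⇒≥ λ γ<4 → <⇒≱ (begin-strict
      α * β                ≤⟨ *-mono-≤ (inj₁ 0<α) (inj₁ 0<β) (inj₁ α<γ) (inj₁ β<γ) ⟩
      γ * γ                <⟨ *-monoˡ-< 0<γ γ<4 ⟩
      fromℕ 4 * γ          ≤⟨ *-monoʳ-≤ (0≤fromℕ 4) (inj₁ γ<4) ⟩
      fromℕ 4 * fromℕ 4    ≈⟨ fromℕ-* 4 4 ⟨
      fromℕ 16             ≤⟨ fromℕ-mono-≤ (ℕ.m≤m+n 16 56) ⟩
      fromℕ 72             ∎) 72≤αβ

    0<β⁻¹ : 0# < β⁻¹
    0<β⁻¹ = ≰⇒> λ β⁻¹≤0 → <⇒≱ 0<1 (begin
      1#        ≈⟨ β*β⁻¹≈1 ⟨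
      β * β⁻¹   ≤⟨ *-monoʳ-≤ (inj₁ 0<β) β⁻¹≤0 ⟩
      β * 0#    ≈⟨ zeroʳ β ⟩
      0#        ∎)

    1≤γβ⁻¹ : 1# ≤ γ * β⁻¹
    1≤γβ⁻¹ = ≤-trans (≤-reflexive (sym β*β⁻¹≈1)) (*-monoˡ-≤ (inj₁ 0<β⁻¹) (inj₁ β<γ))

    0<γ^ : ∀ n → 0# < γ ^ n
    0<γ^ n = ^-pos n 0<γ

    0≤γ^ : ∀ n → 0# ≤ γ ^ n
    0≤γ^ n = inj₁ (0<γ^ n)

    -- Exceeds γ ^ (m + 1), so that the root is alone in its ball at every level but the last, and
    -- exceeds α γ ^ (m + 1), so that the depth cannot be smaller than m + 2.
    rootLength : Carrier
    rootLength = (1# + α) * γ ^ suc m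

    -- A walk of length γ ^ (j + 1) has at most h = ⌊β / 6⌋ edges of this length,
    -- so it reaches codes at distance at most 2 h; and 4 h + 1 ≤ β.
    itemLength : ℕ → Carrier
    itemLength j = fromℕ 6 * (γ ^ suc j * β⁻¹)

    L : ℕ → Carrier
    L 0 = 1#
    L 1 = 1#
    L (suc (suc j)) = if j ℕ.≡ᵇ m then rootLength else itemLength j

    L-cases : ∀ j → (j ≡ m × L (suc (suc j)) ≡ rootLength) ⊎ (j ≢ m × L (suc (suc j)) ≡ itemLength j)
    L-cases j with j ℕ.≡ᵇ m in eq
    ... | true  = inj₁ (ℕ.≡ᵇ⇒≡ j m (subst T (≡.sym eq) tt) , ≡.refl)
    ... | false = inj₂ ((λ j≡m → subst T eq (ℕ.≡⇒≡ᵇ j m j≡m)) , ≡.refl)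

    L-item : ∀ {j} → j ≢ m → L (suc (suc j)) ≡ itemLength j
    L-item {j} j≢m with L-cases j
    ... | inj₁ (j≡m , _) = contradiction j≡m j≢m
    ... | inj₂ (_ , eq)  = eq

    L-root : L (suc (suc m)) ≡ rootLength
    L-root with L-cases m
    ... | inj₁ (_ , eq)  = eq
    ... | inj₂ (m≢m , _) = contradiction ≡.refl m≢m

    γ^<rootLength : γ ^ suc m < rootLength
    γ^<rootLength = begin-strict
      γ ^ suc m           ≈⟨ *-identityˡ _ ⟨
      1# * γ ^ suc m      <⟨ *-monoˡ-< (0<γ^ (suc m)) 1<1+α ⟩
      (1# + α) * γ ^ suc m ∎
      where
      1<1+α : 1# < 1# + α
      1<1+α = ≤-<-trans (≤-reflexive (sym (+-identityʳ 1#))) (+-monoʳ-< 1# 0<α)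

    -- For item edges this is γ / β > 1, the place where β < γ matters: a walk of length γ ^ t
    -- cannot afford any edge of separation beyond t + 1.
    γ^<L : ∀ j → γ ^ j < L (suc (suc j))
    γ^<L j with L-cases j
    ... | inj₁ (≡.refl , L≡) = <-≤-trans (≤-<-trans (x≤y*x (0≤γ^ j) 1≤γ) γ^<rootLength) (≤-reflexive (reflexive (≡.sym L≡)))
    ... | inj₂ (_ , L≡) = begin-strict
      γ ^ j                             ≈⟨ *-identityʳ _ ⟨
      γ ^ j * 1#                        ≤⟨ *-monoʳ-≤ (0≤γ^ j) 1≤γβ⁻¹ ⟩
      γ ^ j * (γ * β⁻¹)                 ≈⟨ solve 3 (λ g c b → g :* (c :* b) := c :* g :* b) refl (γ ^ j) γ β⁻¹ ⟩
      γ ^ suc j * β⁻¹                   ≈⟨ *-identityˡ _ ⟨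
      1# * (γ ^ suc j * β⁻¹)            <⟨ *-monoˡ-< (*-pos (0<γ^ (suc j)) 0<β⁻¹) 1<6 ⟩
      itemLength j                      ≡⟨ L≡ ⟨
      L (suc (suc j))                   ∎
      where
      1<6 : 1# < fromℕ 6
      1<6 = ≤-<-trans (≤-reflexive (sym (+-identityʳ 1#))) (+-monoʳ-< 1# (0<fromℕ-suc 4))

    1≤L : ∀ s → 1# ≤ L s
    1≤L 0 = ≤-refl
    1≤L 1 = ≤-refl
    1≤L (suc (suc j)) = ≤-trans (1≤^ j 1≤γ) (inj₁ (γ^<L j))

    L-far : ∀ {t} s → suc t ℕ.< s → γ ^ t < L s
    L-far {t} (suc (suc j)) (s≤s (s≤s t≤j)) = ≤-<-trans (^-monoʳ-≤ 1≤γ t≤j) (γ^<L j)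

    γ^<[1+h]L : ∀ j → γ ^ suc j < fromℕ (suc h) * L (suc (suc j))
    γ^<[1+h]L j with L-cases j
    ... | inj₁ (≡.refl , L≡) = begin-strict
      γ ^ suc j                                     <⟨ γ^<rootLength ⟩
      rootLength                                    ≡⟨ L≡ ⟨
      L (suc (suc j))                               ≤⟨ x≤y*x (≤-trans 0≤1 (1≤L (suc (suc j)))) (x≤x+y (0≤fromℕ h)) ⟩
      fromℕ (suc h) * L (suc (suc j))               ∎
    ... | inj₂ (_ , L≡) = begin-strict
      γ ^ suc j                                     ≈⟨ *-identityˡ _ ⟨
      1# * γ ^ suc j                                ≈⟨ *-congʳ β*β⁻¹≈1 ⟨
      β * β⁻¹ * γ ^ suc j                           ≈⟨ *-assoc β β⁻¹ _ ⟩
      β * (β⁻¹ * γ ^ suc j)                         <⟨ *-monoˡ-< (*-pos 0<β⁻¹ (0<γ^ (suc j))) β<6[1+h] ⟩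
      fromℕ (suc h) * fromℕ 6 * (β⁻¹ * γ ^ suc j)   ≈⟨ solve 4 (λ x y b g → x :* y :* (b :* g) := x :* (y :* (g :* b))) refl
                                                         (fromℕ (suc h)) (fromℕ 6) β⁻¹ (γ ^ suc j) ⟩
      fromℕ (suc h) * itemLength j                  ≡⟨ cong (fromℕ (suc h) *_) L≡ ⟨
      fromℕ (suc h) * L (suc (suc j))               ∎

    4n+1≤β : ∀ n → fromℕ n * fromℕ 6 ≤ β → fromℕ (suc (4 ℕ.* n)) ≤ β
    -- With n = 0 each ball meets one cluster, and 1 ≤ β is needed; from n = 1 on, 4 n + 1 ≤ 6 n.
    4n+1≤β zero _ = ≤-trans (≤-reflexive (+-identityʳ 1#)) 1≤β
    4n+1≤β n@(suc n′) 6n≤β = begin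
      fromℕ (suc (4 ℕ.* n))   ≤⟨ fromℕ-mono-≤ 4n+1≤n*6 ⟩
      fromℕ (n ℕ.* 6)         ≈⟨ fromℕ-* n 6 ⟩
      fromℕ n * fromℕ 6       ≤⟨ 6n≤β ⟩
      β                       ∎
      where
      4n+1≤n*6 : suc (4 ℕ.* n) ℕ.≤ n ℕ.* 6
      4n+1≤n*6 = ℕ.≤-trans (ℕ.+-monoˡ-≤ (4 ℕ.* n) {1} {2 ℕ.* n} (s≤s z≤n))
        (ℕ.≤-reflexive (≡.trans (≡.sym (ℕ.*-distribʳ-+ n 2 4)) (ℕ.*-comm 6 n)))

    4h+1≤β : fromℕ (suc (4 ℕ.* h)) ≤ β
    4h+1≤β = 4n+1≤β h 6h≤β

    -- The base pairs get their exact diameter 1 instead of α γ, because they may serve at level 0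
    -- of the hierarchy, where only α is allowed.
    Δ : ℕ → Carrier
    Δ zero    = 1#
    Δ (suc j) = α * γ ^ suc (suc j)

    0≤Δ : ∀ j → 0# ≤ Δ j
    0≤Δ zero    = 0≤1
    0≤Δ (suc j) = 0≤* (inj₁ 0<α) (0≤γ^ (suc (suc j)))

    Δ≤αγ^ : ∀ j → Δ j ≤ α * γ ^ suc j
    Δ≤αγ^ zero    = ≤-trans 1≤αγ (≤-reflexive (*-congˡ (sym (*-identityʳ γ))))
    Δ≤αγ^ (suc j) = ≤-refl

    -- Half of the allowance goes to the two inner blocks, by γ ≥ 4, and half to the two chains. The
    -- latter explains 72 = 4 · 3 · 6: the chain bound is multiplied by 4, and an item costs three
    -- edges of length 6 γ ^ (j + 1) / β.
    item-diameter : ∀ j → let ℓ = itemLength j; ρ = Δ j + (ℓ + fromℕ k′ * (ℓ + (ℓ + ℓ))) in ρ + ρ ≤ Δ (suc j)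
    item-diameter j = *-cancelˡ-≤ (0<fromℕ-suc 1) (begin
      fromℕ 2 * (ρ + ρ)
        ≈⟨ solve 2 (λ d r → num 2 :* ((d :+ r) :+ (d :+ r)) := num 4 :* d :+ num 4 :* r) refl (Δ j) ρ′ ⟩
      fromℕ 4 * Δ j + fromℕ 4 * ρ′
        ≤⟨ +-mono-≤ near chain ⟩
      Δ (suc j) + Δ (suc j)
        ≈⟨ solve 1 (λ d → d :+ d := num 2 :* d) refl (Δ (suc j)) ⟩
      fromℕ 2 * Δ (suc j) ∎)
      where
      g = γ ^ suc j
      y = g * β⁻¹
      ℓ = itemLength j
      ρ′ = ℓ + fromℕ k′ * (ℓ + (ℓ + ℓ))
      ρ = Δ j + ρ′
      near : fromℕ 4 * Δ j ≤ Δ (suc j)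
      near = begin
        fromℕ 4 * Δ j       ≤⟨ *-mono-≤ (0≤fromℕ 4) (0≤Δ j) 4≤γ (Δ≤αγ^ j) ⟩
        γ * (α * g)         ≈⟨ solve 3 (λ c a g → c :* (a :* g) := a :* (c :* g)) refl γ α g ⟩
        α * (γ * g)         ∎
      chain : fromℕ 4 * ρ′ ≤ Δ (suc j)
      chain = begin
        fromℕ 4 * ρ′
          -- The one hub edge outside the chain accounts for 24 y; adding 48 y rounds it up to a
          -- full item, turning k′ into k.
          ≤⟨ x≤x+y (0≤* (0≤fromℕ 48) (0≤* (0≤γ^ (suc j)) (inj₁ 0<β⁻¹))) ⟩
        fromℕ 4 * ρ′ + fromℕ 48 * y
          ≈⟨ solve 2 (λ k y → num 4 :* (num 6 :* y :+ k :* (num 6 :* y :+ (num 6 :* y :+ num 6 :* y))) :+ num 48 :* y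
                              := (con 1 :+ k) :* num 72 :* y) refl (fromℕ k′) y ⟩
        fromℕ (suc k′) * fromℕ 72 * y
          ≤⟨ *-monoˡ-≤ (0≤* (0≤γ^ (suc j)) (inj₁ 0<β⁻¹)) 72k≤αβγ ⟩
        α * β * γ * (g * β⁻¹)
          ≈⟨ solve 5 (λ a b c g i → a :* b :* c :* (g :* i) := a :* (c :* g) :* (b :* i)) refl α β γ g β⁻¹ ⟩
        α * (γ * g) * (β * β⁻¹)
          ≈⟨ trans (*-congˡ β*β⁻¹≈1) (*-identityʳ _) ⟩
        α * (γ * g) ∎

    open BlockGraph F k′ m L 1≤L refl

    Δ-step : ∀ j → j ℕ.< m → let ℓ = L (suc (suc j)); ρ = Δ j + (ℓ + fromℕ k′ * (ℓ + (ℓ + ℓ))) in ρ + ρ ≤ Δ (suc j)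
    Δ-step j j<m = subst (λ ℓ → let ρ = Δ j + (ℓ + fromℕ k′ * (ℓ + (ℓ + ℓ))) in ρ + ρ ≤ Δ (suc j))
      (≡.sym (L-item (ℕ.<⇒≢ j<m))) (item-diameter j)

    open Diameters Δ 0≤Δ ≤-refl Δ-step
    open Blocks k′
    open WithConnectivity (λ x y → reach-star (top-reach x y))

    d : ℕ
    d = suc (suc m)

    -- The sum is at most (1 + 2 α) γ ^ (m + 1); twice this is covered by α γ ≥ 2 and γ ≥ 4.
    diameter-≤ : L (suc (suc m)) + Δ m ≤ α * γ ^ d
    diameter-≤ = *-cancelˡ-≤ (0<fromℕ-suc 1) (begin
      fromℕ 2 * (L (suc (suc m)) + Δ m)
        ≡⟨ cong (λ ℓ → fromℕ 2 * (ℓ + Δ m)) L-root ⟩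
      fromℕ 2 * (rootLength + Δ m)
        ≤⟨ *-monoʳ-≤ (0≤fromℕ 2) (+-monoʳ-≤ rootLength (Δ≤αγ^ m)) ⟩
      fromℕ 2 * ((1# + α) * g + α * g)
        ≈⟨ solve 2 (λ a g → num 2 :* ((con 1 :+ a) :* g :+ a :* g) := num 2 :* g :+ num 4 :* (a :* g)) refl α g ⟩
      fromℕ 2 * g + fromℕ 4 * (α * g)
        ≤⟨ +-mono-≤ (*-monoˡ-≤ (0≤γ^ (suc m)) (≤-trans (fromℕ-mono-≤ {2} {72} (s≤s (s≤s z≤n))) (≤-trans 72≤αβ αβ≤αγ)))
                    (*-monoˡ-≤ (0≤* (inj₁ 0<α) (0≤γ^ (suc m))) 4≤γ) ⟩
      α * γ * g + γ * (α * g)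
        ≈⟨ solve 3 (λ a c g → a :* c :* g :+ c :* (a :* g) := num 2 :* (a :* (c :* g))) refl α γ g ⟩
      fromℕ 2 * (α * γ ^ d) ∎)
      where g = γ ^ suc m

    isDepth : IsDepth G α γ d
    isDepth = (λ x y _ _ → reach-dist (λ _ _ → tt) tt (reach-weaken (top-reach x y) diameter-≤))
      , root , just (inn m) , λ w → begin-strict
          α * γ ^ d                ≈⟨ solve 3 (λ a c g → a :* (c :* g) := a :* (c :* g)) refl α γ (γ ^ suc m) ⟩
          α * (γ * γ ^ suc m)      <⟨ *-monoˡ-< (*-pos 0<γ (0<γ^ (suc m))) α<1+α ⟩
          (1# + α) * (γ * γ ^ suc m) ≈⟨ solve 3 (λ a c g → (con 1 :+ a) :* (c :* g) := c :* ((con 1 :+ a) :* g)) refl α γ (γ ^ suc m) ⟩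
          γ * rootLength           ≡⟨ cong (γ *_) L-root ⟨
          γ * L (suc (suc m))      ≤⟨ *-monoʳ-≤ (inj₁ 0<γ) (root-walk (λ ()) w) ⟩
          γ * walkLength G w       ∎
      where
      α<1+α : α < 1# + α
      α<1+α = ≤-<-trans (≤-reflexive (sym (+-identityˡ α))) (+-monoˡ-< α 0<1)

    -- At level 0 the base pairs are clusters if their length 1 is at most α;
    -- otherwise β is large and singletons will do.
    bottom : ℕ
    bottom with 1# ≤? α
    ... | yes _ = 1
    ... | no  _ = 0

    level : ℕ → ℕ
    level zero    = bottom
    level (suc i) = suc i

    bottom≤1 : bottom ℕ.≤ 1
    bottom≤1 with 1# ≤? α
    ... | yes _ = s≤s z≤n
    ... | no  _ = z≤n

    bottom-cases : 1# ≤ α × bottom ≡ 1 ⊎ α < 1# × bottom ≡ 0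
    bottom-cases with 1# ≤? α
    ... | yes 1≤α = inj₁ (1≤α , ≡.refl)
    ... | no  1≰α = inj₂ (≰⇒> 1≰α , ≡.refl)

    pairs-isPartition : 1# ≤ α → IsPartition G α β (γ ^ 0) (clusters 1)
    pairs-isPartition 1≤α = clusters-isPartition {h = h}
      (λ x y p → reach-weaken (cluster-reachᶜ ℕ.≤-refl z≤n x y p) (≤-trans 1≤α (≤-reflexive (sym (*-identityʳ α)))))
      (λ s 2<s → L-far s (ℕ.<-trans (s≤s (s≤s z≤n)) 2<s))
      -- The clusters are those of level 1 but the radius is only 1, so the estimate for radius γ
      -- applies a fortiori.
      (≤-<-trans (^-monoʳ-≤ {m = 0} {1} 1≤γ z≤n) (γ^<[1+h]L 0)) 4h+1≤β

    -- Here h = 1: a walk of length 1 uses at most one base edge, and the resulting bound 5 is below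
    -- β because β > α β ≥ 72 when α < 1.
    singletons-isPartition : α < 1# → IsPartition G α β (γ ^ 0) (clusters 0)
    singletons-isPartition α<1 = clusters-isPartition {h = 1}
      (λ x y p → subst (λ z → Reachᶜ 0 x z (α * 1#)) (sepᶜ≡0⇒≡ x y (ℕ.n≤0⇒n≡0 p)) (here (0≤* (inj₁ 0<α) 0≤1)))
      L-far
      (begin-strict
        1#              <⟨ ≤-<-trans (≤-reflexive (sym (+-identityʳ 1#))) (+-monoʳ-< 1# (0<fromℕ-suc 0)) ⟩
        fromℕ 2         ≈⟨ *-identityʳ _ ⟨
        fromℕ 2 * 1#    ∎)
      (begin
        fromℕ 5         ≤⟨ fromℕ-mono-≤ (ℕ.m≤m+n 5 67) ⟩
        fromℕ 72        ≤⟨ 72≤αβ ⟩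
        α * β           ≤⟨ *-monoˡ-≤ (inj₁ 0<β) (inj₁ α<1) ⟩
        1# * β          ≈⟨ *-identityˡ β ⟩
        β               ∎)

    bottom-isPartition : IsPartition G α β (γ ^ 0) (clusters bottom)
    bottom-isPartition = Sum.[ (λ (1≤α , eq) → relevel eq (pairs-isPartition 1≤α))
                             , (λ (α<1 , eq) → relevel eq (singletons-isPartition α<1)) ]′ bottom-cases
      where
      relevel : ∀ {t} → bottom ≡ t → IsPartition G α β (γ ^ 0) (clusters t) → IsPartition G α β (γ ^ 0) (clusters bottom)
      relevel eq = subst (λ t → IsPartition G α β (γ ^ 0) (clusters t)) (≡.sym eq)

    level-isPartition : ∀ i → i ℕ.≤ d → IsPartition G α β (γ ^ i) (clusters (level i))
    level-isPartition zero _ = bottom-isPartition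
    level-isPartition (suc j) (s≤s j≤1+m) = clusters-isPartition {h = h} reach
      L-far (γ^<[1+h]L j) 4h+1≤β
      where
      reach : ∀ x y → sepᶜ x y ℕ.≤ suc j → Reachᶜ (suc j) x y (α * γ ^ suc j)
      reach x y p with ℕ.m≤n⇒m<n∨m≡n j≤1+m
      ... | inj₁ (s≤s j≤m) = reach-weaken (cluster-reachᶜ ℕ.≤-refl j≤m x y p) (Δ≤αγ^ j)
      ... | inj₂ ≡.refl    = reach-weaken (top-reach x y) diameter-≤

    H : Hierarchy G α β γ root
    H = record
      { depth       = d
      ; isDepth     = isDepth
      ; part        = λ i → clusters (level (toℕ i))
      ; isPartition = λ i → level-isPartition (toℕ i) (Fin.toℕ≤pred[n] i)
      ; top         = λ x y → subst (λ n → sepᶜ x y ℕ.≤ level n) (≡.sym (Fin.toℕ-fromℕ d)) (sepᶜ-bound x y)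
      ; refines     = λ i p → ℕ.≤-trans p
          (subst (λ n → level n ℕ.≤ suc (toℕ i)) (≡.sym (Fin.toℕ-inject₁ i)) (level-suc (toℕ i)))
      ; rootPadding = λ i → root , padding (toℕ i) (Fin.toℕ≤pred[n] i)
      }
      where
      level-suc : ∀ i → level i ℕ.≤ suc i
      level-suc zero    = bottom≤1
      level-suc (suc i) = ℕ.n≤1+n _
      -- Before the last level the ball is the root alone, since every root edge is too long; at the
      -- last level there is only one cluster.
      padding : ∀ i → i ℕ.≤ d → ∀ x → Ball G root (γ ^ i) x → sepᶜ root x ℕ.≤ level i
      padding i i≤d nothing  _ = z≤n
      padding i i≤d (just v) (w , w≤γ^i) = Sum.[ (λ { (s≤s i≤1+m) → contradiction w≤γ^i (<⇒≱ (outside i≤1+m)) })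
                                               , (λ { ≡.refl → ℕ.≤-refl }) ]′ (ℕ.m≤n⇒m<n∨m≡n i≤d)
        where
        outside : ∀ {i} → i ℕ.≤ suc m → γ ^ i < walkLength G w
        outside {i} i≤1+m = begin-strict
          γ ^ i                ≤⟨ ^-monoʳ-≤ 1≤γ i≤1+m ⟩
          γ ^ suc m            <⟨ γ^<rootLength ⟩
          rootLength           ≡⟨ L-root ⟨
          L (suc (suc m))      ≤⟨ root-walk (λ ()) w ⟩
          walkLength G w       ∎

    strict-obeys : ∀ {τ} → StrictlyObeys G τ H → ∀ t → 1 ℕ.≤ t → t ℕ.≤ d → ∀ x y → sepᶜ x y ℕ.≤ t →
      Star (λ u v → T (Subgraph.edge τ u v) × sepᶜ x u ℕ.≤ t × sepᶜ x v ℕ.≤ t) x y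
    strict-obeys {τ} obeys t@(suc _) _ t≤d x y p = subst
      (λ n → Star (λ u v → T (Subgraph.edge τ u v) × sepᶜ x u ℕ.≤ n × sepᶜ x v ℕ.≤ n) x y) level≡t
      (obeys (Fin.fromℕ< (s≤s t≤d)) x y (subst (sepᶜ x y ℕ.≤_) (≡.sym level≡t) p))
      where
      level≡t : level (toℕ (Fin.fromℕ< (s≤s t≤d))) ≡ t
      level≡t = cong level (Fin.toℕ-fromℕ< (s≤s t≤d))

    order-≥ : m ℕ.≤ Graph.order G
    order-≥ = ℕ.m≤n⇒m≤1+n (size-≥ m)
      where
      size-≥ : ∀ j → j ℕ.≤ size j
      size-≥ zero    = z≤n
      size-≥ (suc j) = ℕ.≤-trans (s≤s (size-≥ j)) (ℕ.m≤m+n _ _)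

    -- One level multiplies the order by at most k + 1, and k + 1 ≤ 72 k ≤ α β γ ≤ γ³; the extra
    -- factor γ covers the three vertices present for m = 0.
    order-≤ : fromℕ (Graph.order G) ≤ γ ^ suc (3 ℕ.* m)
    order-≤ = begin
      fromℕ (suc (size m))         ≤⟨ size-≤ m ⟩
      γ * (γ ^ 3) ^ m              ≈⟨ *-congˡ (^-assocʳ γ 3 m) ⟩
      γ ^ suc (3 ℕ.* m)            ∎
      where
      k+1≤γ³ : fromℕ (suc k) ≤ γ ^ 3
      k+1≤γ³ = begin
        fromℕ (suc k)            ≤⟨ fromℕ-mono-≤ 1+k≤k*72 ⟩
        fromℕ (k ℕ.* 72)         ≈⟨ fromℕ-* k 72 ⟩
        fromℕ k * fromℕ 72       ≤⟨ 72k≤αβγ ⟩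
        α * β * γ                ≤⟨ *-monoˡ-≤ (inj₁ 0<γ) (*-mono-≤ (inj₁ 0<α) (inj₁ 0<β) (inj₁ α<γ) (inj₁ β<γ)) ⟩
        γ * γ * γ                ≈⟨ solve 1 (λ c → c :* c :* c := c :* (c :* (c :* con 1))) refl γ ⟩
        γ ^ 3                    ∎
        where
        1+k≤k*72 : suc k ℕ.≤ k ℕ.* 72
        1+k≤k*72 = ℕ.≤-trans (s≤s (s≤s (ℕ.m≤n⇒m≤o+n 70 (ℕ.m≤m*n k′ 72)))) ℕ.≤-refl
      size-≤ : ∀ j → fromℕ (suc (size j)) ≤ γ * (γ ^ 3) ^ j
      size-≤ zero = ≤-trans (fromℕ-mono-≤ (ℕ.n≤1+n 3)) (≤-trans 4≤γ (≤-reflexive (sym (*-identityʳ γ))))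
      size-≤ (suc j) = begin
        fromℕ (suc (k ℕ.* suc (size j)))            ≤⟨ fromℕ-mono-≤ (ℕ.+-monoˡ-≤ (k ℕ.* suc (size j)) (s≤s (z≤n {size j}))) ⟩
        fromℕ (suc k ℕ.* suc (size j))              ≈⟨ fromℕ-* (suc k) (suc (size j)) ⟩
        fromℕ (suc k) * fromℕ (suc (size j))        ≤⟨ *-mono-≤ (0≤fromℕ (suc k)) (0≤fromℕ (suc (size j))) k+1≤γ³ (size-≤ j) ⟩
        γ ^ 3 * (γ * (γ ^ 3) ^ j)                   ≈⟨ solve 3 (λ x c y → x :* (c :* y) := c :* (x :* y)) refl (γ ^ 3) γ ((γ ^ 3) ^ j) ⟩
        γ * (γ ^ 3) ^ suc j                         ∎

    -- The first hypothesis pays, per level, for the fourth power of the rounding loss 144 and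
    -- leaves a factor 2. The resulting 2 ^ m must absorb what `m-large` collects: the desired γ ^
    -- 4, the extra α β in the exponent 3 m + 1, and the part of the root length independent of m.
    module _ (2*144⁴≤αβ : fromℕ 2 * fromℕ 144 ^ 4 ≤ α * β)
             (m-large : γ ^ 4 * (α * β) * ((1# + α) * γ) ^ 4 ≤ fromℕ m) where

      p : Carrier
      p = α * β

      0≤p : 0# ≤ p
      0≤p = 0≤* (inj₁ 0<α) (inj₁ 0<β)

      1≤p : 1# ≤ p
      1≤p = ≤-trans (x≤x+y (0≤fromℕ 71)) 72≤αβ

      -- Fourth powers replace the exponent 1 / 4. From k ^ m ≥ (α β γ / 144) ^ m one gets (α β) ^
      -- (4 m) up to the losses; 3 m of these factors are kept and m are spent on the losses.
      stretch-power : ∀ {s} → fromℕ (k ℕ.^ m) ≤ s * L (suc (suc m)) → γ ^ 4 * p ^ suc (3 ℕ.* m) ≤ s ^ 4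
      stretch-power {s} k^m≤sW = *-cancelˡ-≤ {D ^ 4 * W ^ 4} (*-pos (^-pos 4 0<D) (^-pos 4 0<W)) (begin
        D ^ 4 * W ^ 4 * (γ ^ 4 * (p * p ^ (3 ℕ.* m)))
          ≈⟨ *-cong (*-congˡ (trans (^-congˡ 4 (sym (*-assoc (1# + α) γ Q))) (^-distrib-* ((1# + α) * γ) Q 4)))
                    (*-congˡ (*-congˡ (trans (reflexive (cong (p ^_) (ℕ.*-comm 3 m))) (sym (^-assocʳ p m 3))))) ⟩
        D ^ 4 * (((1# + α) * γ) ^ 4 * Q ^ 4) * (γ ^ 4 * (p * P ^ 3))
          ≈⟨ solve 6 (λ d a q g p c → d :* (a :* q) :* (g :* (p :* c)) := (g :* p :* a) :* d :* (c :* q)) refl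
               (D ^ 4) (((1# + α) * γ) ^ 4) (Q ^ 4) (γ ^ 4) p (P ^ 3) ⟩
        γ ^ 4 * p * ((1# + α) * γ) ^ 4 * D ^ 4 * (P ^ 3 * Q ^ 4)
          -- The quantity bounded by m is bounded by 2 ^ m, which matches the spare factor 2 per
          -- level.
          ≤⟨ *-monoˡ-≤ (0≤* (0≤^ 3 0≤P) (0≤^ 4 0≤Q)) (*-monoˡ-≤ (0≤^ 4 (inj₁ 0<D)) (≤-trans m-large (fromℕ≤2^ m))) ⟩
        fromℕ 2 ^ m * D ^ 4 * (P ^ 3 * Q ^ 4)
          ≤⟨ *-monoˡ-≤ (0≤* (0≤^ 3 0≤P) (0≤^ 4 0≤Q)) powers ⟩
        P * (P ^ 3 * Q ^ 4)
          ≈⟨ trans (sym (*-assoc P (P ^ 3) (Q ^ 4))) (sym (^-distrib-* P Q 4)) ⟩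
        (P * Q) ^ 4
          ≈⟨ ^-congˡ 4 (^-distrib-* p γ m) ⟨
        ((p * γ) ^ m) ^ 4
          ≤⟨ ^-monoˡ-≤ 4 (0≤^ m (0≤* 0≤p (inj₁ 0<γ))) (^-monoˡ-≤ m (0≤* 0≤p (inj₁ 0<γ)) αβγ≤144k) ⟩
        ((fromℕ 144 * fromℕ k) ^ m) ^ 4
          ≈⟨ ^-congˡ 4 (trans (^-distrib-* (fromℕ 144) (fromℕ k) m) (*-congˡ (sym (fromℕ-^ k m)))) ⟩
        (D * fromℕ (k ℕ.^ m)) ^ 4
          ≤⟨ ^-monoˡ-≤ 4 (0≤* (inj₁ 0<D) (0≤fromℕ (k ℕ.^ m))) (*-monoʳ-≤ (inj₁ 0<D) k^m≤sW) ⟩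
        (D * (s * L (suc (suc m)))) ^ 4
          ≡⟨ cong (λ w → (D * (s * w)) ^ 4) L-root ⟩
        (D * (s * W)) ^ 4
          ≈⟨ trans (^-distrib-* D (s * W) 4) (*-congˡ (^-distrib-* s W 4)) ⟩
        D ^ 4 * (s ^ 4 * W ^ 4)
          ≈⟨ solve 3 (λ d s w → d :* (s :* w) := d :* w :* s) refl (D ^ 4) (s ^ 4) (W ^ 4) ⟩
        D ^ 4 * W ^ 4 * s ^ 4 ∎)
        where
        D = fromℕ 144 ^ m
        W = rootLength
        P = p ^ m
        Q = γ ^ m
        0<D : 0# < D
        0<D = ^-pos m (0<fromℕ-suc 143)
        0<W : 0# < W
        0<W = ≤-<-trans (0≤γ^ (suc m)) γ^<rootLength
        0≤P = 0≤^ m 0≤p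
        0≤Q = 0≤γ^ m
        powers : fromℕ 2 ^ m * D ^ 4 ≤ P
        powers = begin
          fromℕ 2 ^ m * (fromℕ 144 ^ m) ^ 4   ≈⟨ *-congˡ (^-assocʳ (fromℕ 144) m 4) ⟩
          fromℕ 2 ^ m * fromℕ 144 ^ (m ℕ.* 4) ≡⟨ cong (λ n → fromℕ 2 ^ m * fromℕ 144 ^ n) (ℕ.*-comm m 4) ⟩
          fromℕ 2 ^ m * fromℕ 144 ^ (4 ℕ.* m) ≈⟨ *-congˡ (^-assocʳ (fromℕ 144) 4 m) ⟨
          fromℕ 2 ^ m * (fromℕ 144 ^ 4) ^ m   ≈⟨ ^-distrib-* (fromℕ 2) (fromℕ 144 ^ 4) m ⟨
          (fromℕ 2 * fromℕ 144 ^ 4) ^ m       ≤⟨ ^-monoˡ-≤ m (0≤* (0≤fromℕ 2) (0≤^ 4 (0≤fromℕ 144))) 2*144⁴≤αβ ⟩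
          p ^ m                               ∎

      scaledPowLog : ∀ {s} → γ ^ 4 * p ^ suc (3 ℕ.* m) ≤ s ^ 4 → ScaledPowLog≤ γ p γ (Graph.order G) 4 (fromℕ 1 * s)
      scaledPowLog {s} key a q _ γ^a≤n^q = begin
        γ ^ (4 ℕ.* q) * p ^ a                        ≤⟨ *-monoʳ-≤ (0≤γ^ (4 ℕ.* q)) (^-monoʳ-≤ 1≤p a≤) ⟩
        γ ^ (4 ℕ.* q) * p ^ (suc (3 ℕ.* m) ℕ.* q)    ≈⟨ *-cong (^-assocʳ γ 4 q) (^-assocʳ p (suc (3 ℕ.* m)) q) ⟨
        (γ ^ 4) ^ q * (p ^ suc (3 ℕ.* m)) ^ q        ≈⟨ ^-distrib-* (γ ^ 4) (p ^ suc (3 ℕ.* m)) q ⟨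
        (γ ^ 4 * p ^ suc (3 ℕ.* m)) ^ q              ≤⟨ ^-monoˡ-≤ q (0≤* (0≤γ^ 4) (0≤^ (suc (3 ℕ.* m)) 0≤p)) key ⟩
        (s ^ 4) ^ q                                  ≈⟨ ^-assocʳ s 4 q ⟩
        s ^ (4 ℕ.* q)                                ≈⟨ ^-congˡ (4 ℕ.* q) (trans (*-congʳ (+-identityʳ 1#)) (*-identityˡ s)) ⟨
        (fromℕ 1 * s) ^ (4 ℕ.* q)                    ∎
        where
        a≤ : a ℕ.≤ suc (3 ℕ.* m) ℕ.* q
        -- The rational a / q is at most log n to base γ, hence at most 3 m + 1 by the bound on the
        -- order; as α β ≥ 1, the exponent may be raised to that.
        a≤ = ^-cancel-≤ 1<γ (begin
          γ ^ a                          ≤⟨ γ^a≤n^q ⟩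
          fromℕ (Graph.order G) ^ q      ≤⟨ ^-monoˡ-≤ q (0≤fromℕ (Graph.order G)) order-≤ ⟩
          (γ ^ suc (3 ℕ.* m)) ^ q        ≈⟨ ^-assocʳ γ (suc (3 ℕ.* m)) q ⟩
          γ ^ (suc (3 ℕ.* m) ℕ.* q)      ∎)

      stretch-bound : ∀ τ → IsSpanningTree G τ → StrictlyObeys G τ H → ∀ s → IsStretch G root τ s →
                      ScaledPowLog≤ γ p γ (Graph.order G) 4 (fromℕ 1 * s)
      stretch-bound τ spanning obeys s stretch =
        scaledPowLog (stretch-power (stretch-≥ τ spanning (strict-obeys {τ} obeys) stretch))

-- Choice of the parameters and conclusion.

module _ {c ℓ₁ ℓ₂} (F : ArchimedeanOrderedField c ℓ₁ ℓ₂) where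

  open ArchimedeanOrderedField F
  open Steiner F
  open OrderedFieldProperties F

  -- As the floor k of x / 72 is at least 1, rounding loses at most a factor 2: k + 1 ≤ 2 k, whence
  -- 144.
  positive-floor : ∀ {x} → fromℕ 72 ≤ x →
    ∃[ k′ ] fromℕ (suc k′) * fromℕ 72 ≤ x × x ≤ fromℕ 144 * fromℕ (suc k′)
  positive-floor {x} 72≤x with floor (fromℕ 72) x (x≤x+y (0≤fromℕ 71)) (≤-trans (0≤fromℕ 72) 72≤x)
  ... | zero   , _   , x<  = contradiction 72≤x
    (<⇒≱ (<-≤-trans x< (≤-reflexive (trans (*-congʳ (+-identityʳ 1#)) (*-identityˡ (fromℕ 72))))))
  ... | suc k′ , ≤x , x<  = k′ , ≤x , (begin
    x                                        ≤⟨ inj₁ x< ⟩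
    fromℕ (suc (suc k′)) * fromℕ 72          ≈⟨ fromℕ-* (suc (suc k′)) 72 ⟨
    fromℕ (suc (suc k′) ℕ.* 72)              ≤⟨ fromℕ-mono-≤ (ℕ.+-monoʳ-≤ 144 (ℕ.*-monoʳ-≤ k′ (ℕ.m≤m+n 72 72))) ⟩
    fromℕ (suc k′ ℕ.* 144)                   ≡⟨ cong fromℕ (ℕ.*-comm (suc k′) 144) ⟩
    fromℕ (144 ℕ.* suc k′)                   ≈⟨ fromℕ-* 144 (suc k′) ⟩
    fromℕ 144 * fromℕ (suc k′)               ∎)
    where open ≤-Reasoning

  hard-hierarchy : ∀ K → 72 ℕ.≤ K → fromℕ 2 * fromℕ 144 ^ 4 ≤ fromℕ K →
    ∀ (α β γ : Carrier) → 0# < α → 1# ≤ β → α < γ → β < γ → fromℕ K ≤ α * β → ∀ (N : ℕ) →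
    Σ[ G ∈ Graph ] (N ℕ.≤ Graph.order G) ×
    (Σ[ r ∈ Graph.V G ] Σ[ H ∈ Hierarchy G α β γ r ]
      (∀ (τ : Subgraph G) → IsSpanningTree G τ → StrictlyObeys G τ H →
       ∀ (s : Carrier) → IsStretch G r τ s →
       ScaledPowLog≤ γ (α * β) γ (Graph.order G) 4 (fromℕ 1 * s)))
  hard-hierarchy K 72≤K 2*144⁴≤K α β γ 0<α 1≤β α<γ β<γ K≤αβ N =
    _ , ℕ.≤-trans (ℕ.m≤n+m N m₀) order-≥ , _ , H
    , stretch-bound (≤-trans 2*144⁴≤K K≤αβ)
        (≤-trans (inj₁ (proj₂ large)) (fromℕ-mono-≤ (ℕ.m≤m+n m₀ N)))
    where
    72≤αβ : fromℕ 72 ≤ α * β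
    72≤αβ = ≤-trans (fromℕ-mono-≤ 72≤K) K≤αβ
    0<β : 0# < β
    0<β = <-≤-trans 0<1 1≤β
    1≤γ : 1# ≤ γ
    1≤γ = inj₁ (≤-<-trans 1≤β β<γ)
    items = positive-floor (≤-trans 72≤αβ (x≤x*y (0≤* (inj₁ 0<α) (inj₁ 0<β)) 1≤γ))
    width = floor (fromℕ 6) β (x≤x+y (0≤fromℕ 5)) (inj₁ 0<β)
    reciprocal = inverse β λ β≈0 → <-irrefl (sym β≈0) 0<β
    large = archimedean (γ ^ 4 * (α * β) * ((1# + α) * γ) ^ 4)
    m₀ = proj₁ large
    open LowerBound F {k′ = proj₁ items} {h = proj₁ width} 0<α 1≤β α<γ β<γ 72≤αβ
      (proj₂ reciprocal) (proj₁ (proj₂ items)) (proj₂ (proj₂ items))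
      -- The summand m₀ makes m large enough to absorb the losses, and N makes the order at least N.
      (proj₁ (proj₂ width)) (proj₂ (proj₂ width)) (m₀ ℕ.+ N)

theorem7 : ∀ {c ℓ₁ ℓ₂} → ∃[ C ] ∃[ K ]
    ∀ (F : ArchimedeanOrderedField c ℓ₁ ℓ₂) →
    let open ArchimedeanOrderedField F
        open Steiner F
    in
    ∀ (α β γ : Carrier) → 0# < α → 1# ≤ β → α < γ → β < γ →
    fromℕ K ≤ α * β →
    ∀ (N : ℕ) →
    Σ[ G ∈ Graph ] (N ℕ.≤ Graph.order G) ×
    (Σ[ r ∈ Graph.V G ] Σ[ H ∈ Hierarchy G α β γ r ]
      (∀ (τ : Subgraph G) → IsSpanningTree G τ → StrictlyObeys G τ H →
       ∀ (s : Carrier) → IsStretch G r τ s →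
       ScaledPowLog≤ γ (α * β) γ (Graph.order G) 4 (fromℕ C * s)))
-- All losses are absorbed by α β and m, so C = 1; K is the product of 144⁴, the loss per level, and
-- the spare factor 2.
theorem7 = 1 , 2 ℕ.* 144 ℕ.^ 4 , λ F →
  let open ArchimedeanOrderedField F
      open OrderedFieldProperties F
  in hard-hierarchy F (2 ℕ.* 144 ℕ.^ 4) (ℕ.≤ᵇ⇒≤ 72 (2 ℕ.* 144 ℕ.^ 4) tt)
       (≤-reflexive (sym (trans (fromℕ-* 2 (144 ℕ.^ 4)) (*-congˡ (fromℕ-^ 144 4)))))
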